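{- For every integer $n \ge 0$, let $d_2(n)$ denote the number of overpartitions of $n$ in which only even parts may be overlined. For an integer $m$ write $\omega_m = m(3m+1)/2$. Then for all $n \ge 0$, $$d_2(n) \equiv \begin{cases} 1 \pmod 4 & \text{if } n = \omega_{4k} \text{ or } n = \omega_{4k+3} \text{ for some integer } k,\\ 3 \pmod 4 & \text{if } n = \omega_{4k+1} \text{ or } n = \omega_{4k+2} \text{ for some integer } k,\\ 0 \pmod 4 & \text{otherwise}.\end{cases}$$
   Context: A partition of $n$ is a non-increasing finite sequence of positive integers (parts) summing to $n$; the empty partition is the unique partition of $0$. An overpartition of $n$ is a partition of $n$ in which the first occurrence of each distinct part value may (optionally) be overlined; equivalently it is a pair $(\mu,\nu)$ where $\mu$ is a partition (the non-overlined parts) and $\nu$ is a partition into distinct parts (the overlined parts) with $|\mu|+|\nu| = n$. The quantity $d_2(n)$ counts those overpartitions of $n$ whose overlined parts are all even, i.e. pairs $(\mu,\nu)$ with $\nu$ a partition into distinct even parts. Its generating function is $\sum_{n\ge0} d_2(n)q^n = \prod_{i\ge1}\frac{1+q^{2i}}{1-q^i}$. The integer $k$ ranges over all integers (positive, zero, or negative), so the $\omega_m$ are the generalized pentagonal numbers. -}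

module Defs where

open import Data.Nat using (ℕ; _+_; _*_; _>_; _≥_; _%_)
open import Data.Nat.Divisibility using (_∣_)
open import Data.Integer as ℤ using (ℤ; +_)
open import Data.List using (List; length)
open import Data.Nat.ListAction using (sum)
open import Data.Sum using (_⊎_)
open import Data.List.Relation.Unary.All using (All)
open import Data.List.Relation.Unary.Linked using (Linked)
open import Data.List.Relation.Unary.Unique.Propositional using (Unique)
open import Data.List.Membership.Propositional using (_∈_)
open import Data.Product using (_×_; ∃; proj₁; proj₂)
open import Relation.Binary.PropositionalEquality using (_≡_)
open import Function.Bundles using (_⇔_)

IsPartitionList : List ℕ → Set
IsPartitionList xs = Linked _≥_ xs × All (λ x → x > 0) xs

IsDistinctEvenList : List ℕ → Set
IsDistinctEvenList xs = Linked _>_ xs × All (λ x → (x > 0) × (2 ∣ x)) xs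

-- An overpartition of n whose overlined parts are all even, as a pair (μ , ν):
-- μ the non-overlined parts, ν the overlined parts, |μ| + |ν| = n.
IsEvenOverpartition : ℕ → List ℕ × List ℕ → Set
IsEvenOverpartition n p =
  IsPartitionList (proj₁ p) × IsDistinctEvenList (proj₂ p) × (sum (proj₁ p) + sum (proj₂ p) ≡ n)

-- L is an exhaustive duplicate-free listing of the overpartitions counted by d₂(n);
-- hence length L = d₂(n).
Enumerates-d₂ : ℕ → List (List ℕ × List ℕ) → Set
Enumerates-d₂ n L = Unique L × (∀ p → (p ∈ L) ⇔ IsEvenOverpartition n p)

-- n = ω_m = m(3m+1)/2, stated without division as 2n = m(3m+1).
IsOmega : ℕ → ℤ → Set
IsOmega n m = (+ 2) ℤ.* (+ n) ≡ m ℤ.* ((+ 3) ℤ.* m ℤ.+ (+ 1))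

CaseOne : ℕ → Set
CaseOne n = ∃ λ (k : ℤ) → IsOmega n ((+ 4) ℤ.* k) ⊎ IsOmega n ((+ 4) ℤ.* k ℤ.+ (+ 3))

CaseThree : ℕ → Set
CaseThree n = ∃ λ (k : ℤ) → IsOmega n ((+ 4) ℤ.* k ℤ.+ (+ 1)) ⊎ IsOmega n ((+ 4) ℤ.* k ℤ.+ (+ 2))

{-# OPTIONS --safe #-}

-- Let y = q². Splitting the factors by the parity of i,
--   ∏ (1 - q^i) · ∏ (1 - (-q)^i) = ∏ (1 - y^(2i-1)) · ∏ (1 - y^i)².
-- Modulo 4 one has (1 - x)² ≡ (1 + x)², so the last factor becomes ∏ (1 + y^i)², and
-- Euler's identity ∏ (1 - y^(2i-1)) · ∏ (1 + y^i) = 1 leaves ∏ (1 + y^i). Dividing by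
-- ∏ (1 - q^i), the generating function of d₂ is congruent to ∏ (1 - (-q)^i), which the
-- pentagonal number theorem expands as Σ (-1)^m (-q)^(ω m), with sign (-1)^(m(m+1)/2).
--
-- To find the n-th coefficient everything is computed in (ℤ/4)[q]/(q^(n+1)), where the
-- infinite products are finite, and the pentagonal number theorem is Shanks' finite identity
--   Σ_{s≤n} (-1)^s ∏_{s<i≤n} (1 - x^i) x^(sn+s(s+1)/2) = Σ_{|m|≤n} (-1)^m x^(ω m),
-- in which every term with s ≥ 1 on the left vanishes.
module Submission where

open import Defs
open import Algebra.Bundles using (CommutativeRing)
open import Data.Empty using (⊥-elim)
open import Data.Integer as ℤ using (ℤ; +_; -[1+_]; ∣_∣)
open import Data.Integer.DivMod using (_%ℕ_; _/ℕ_; n%ℕd<d; a≡a%ℕn+[a/ℕn]*n)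
import Data.Integer.Properties as ℤ
open import Data.Integer.Tactic.RingSolver using () renaming (solve-∀ to ℤ-solve-∀)
open import Data.List using (List; []; _∷_; _++_; map; length)
open import Data.List.Membership.Propositional using (_∈_)
open import Data.List.Membership.Propositional.Properties using (∈-map⁺; ∈-map⁻; ++-∈⇔)
open import Data.List.Properties using (++-identityʳ; length-map; length-++)
open import Data.List.Relation.Unary.All as All using (All; []; _∷_)
open import Data.List.Relation.Unary.AllPairs using ([]; _∷_)
open import Data.List.Relation.Unary.Any using (here)
open import Data.List.Relation.Unary.Linked as Linked using (Linked; []; [-]; _∷_)
open import Data.List.Relation.Unary.Linked.Properties using (Linked⇒All)
open import Data.List.Relation.Unary.Unique.Propositional using (Unique)
import Data.List.Relation.Unary.Unique.Propositional.Properties as Unique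
open import Data.Nat as ℕ using (ℕ; zero; suc; _∸_; _≤_; _<_; z≤n; s≤s; _%_)
open import Data.Nat.Divisibility using (_∣_; divides)
open import Data.Nat.DivMod using (%-distribˡ-+; %-distribˡ-*; m*n%n≡0)
open import Data.Nat.Induction using (<-rec)
open import Data.Nat.ListAction using (sum)
import Data.Nat.Properties as ℕ
open import Data.Nat.Tactic.RingSolver using () renaming (solve-∀ to ℕ-solve-∀)
open import Data.Product using (_×_; _,_; ∃; proj₁; proj₂)
open import Data.Sum as Sum using (_⊎_; inj₁; inj₂)
open import Function using (_∘_)
open import Function.Bundles using (_⇔_; mk⇔; Equivalence)
open import Function.Construct.Composition using (_⇔-∘_)
open import Level using (0ℓ)
open import Relation.Binary using (Rel; Transitive)
open import Relation.Binary.PropositionalEquality as ≡ using (_≡_; _≢_)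
open import Relation.Nullary using (¬_; yes; no; contradiction)

-- Pentagonal numbers

tri : ℕ → ℕ
tri zero    = 0
tri (suc k) = tri k ℕ.+ suc k

-- No halving occurs, and the clauses have the shape `s * n + tri s` with s = n and with s = n + 1.
-- These are the exponents that Shanks' identity produces at the end of its sum, so they match there
-- by definition.
ω : ℤ → ℕ
ω (+ k)    = k ℕ.* k ℕ.+ tri k
ω -[1+ j ] = suc j ℕ.* j ℕ.+ tri (suc j)

2*tri : ∀ k → tri k ℕ.+ tri k ≡ k ℕ.* suc k
2*tri zero    = ≡.refl
2*tri (suc k) = begin
  (tri k ℕ.+ suc k) ℕ.+ (tri k ℕ.+ suc k)  ≡⟨ rearrange (tri k) k ⟩
  (tri k ℕ.+ tri k) ℕ.+ 2 ℕ.* suc k        ≡⟨ ≡.cong (ℕ._+ 2 ℕ.* suc k) (2*tri k) ⟩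
  k ℕ.* suc k ℕ.+ 2 ℕ.* suc k              ≡⟨ factor k ⟩
  suc k ℕ.* suc (suc k)                    ∎
  where
  open ≡.≡-Reasoning
  rearrange : ∀ t k → (t ℕ.+ suc k) ℕ.+ (t ℕ.+ suc k) ≡ (t ℕ.+ t) ℕ.+ 2 ℕ.* suc k
  rearrange = ℕ-solve-∀
  factor : ∀ k → k ℕ.* suc k ℕ.+ 2 ℕ.* suc k ≡ suc k ℕ.* suc (suc k)
  factor = ℕ-solve-∀

ω-IsOmega : ∀ m → IsOmega (ω m) m
ω-IsOmega (+ k) = begin
  + 2 ℤ.* + ω (+ k)                    ≡⟨ ℤ.pos-* 2 (ω (+ k)) ⟨
  + (2 ℕ.* (k ℕ.* k ℕ.+ tri k))        ≡⟨ ≡.cong +_ (double k (tri k)) ⟩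
  + (2 ℕ.* (k ℕ.* k) ℕ.+ (tri k ℕ.+ tri k))  ≡⟨ ≡.cong (λ t → + (2 ℕ.* (k ℕ.* k) ℕ.+ t)) (2*tri k) ⟩
  + (2 ℕ.* (k ℕ.* k) ℕ.+ k ℕ.* suc k)  ≡⟨ ≡.cong +_ (factor k) ⟩
  + (k ℕ.* (3 ℕ.* k ℕ.+ 1))            ≡⟨ ℤ.pos-* k (3 ℕ.* k ℕ.+ 1) ⟩
  + k ℤ.* (+ (3 ℕ.* k) ℤ.+ + 1)        ≡⟨ ≡.cong (λ i → + k ℤ.* (i ℤ.+ + 1)) (ℤ.pos-* 3 k) ⟩
  + k ℤ.* (+ 3 ℤ.* + k ℤ.+ + 1)        ∎
  where
  open ≡.≡-Reasoning
  double : ∀ k t → 2 ℕ.* (k ℕ.* k ℕ.+ t) ≡ 2 ℕ.* (k ℕ.* k) ℕ.+ (t ℕ.+ t)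
  double = ℕ-solve-∀
  factor : ∀ k → 2 ℕ.* (k ℕ.* k) ℕ.+ k ℕ.* suc k ≡ k ℕ.* (3 ℕ.* k ℕ.+ 1)
  factor = ℕ-solve-∀
ω-IsOmega -[1+ j ] = begin
  + 2 ℤ.* + ω -[1+ j ]                 ≡⟨ ℤ.pos-* 2 (ω -[1+ j ]) ⟨
  + (2 ℕ.* (suc j ℕ.* j ℕ.+ tri (suc j)))    ≡⟨ ≡.cong +_ (double j (tri (suc j))) ⟩
  + (2 ℕ.* (suc j ℕ.* j) ℕ.+ (tri (suc j) ℕ.+ tri (suc j)))  ≡⟨ ≡.cong (λ t → + (2 ℕ.* (suc j ℕ.* j) ℕ.+ t)) (2*tri (suc j)) ⟩
  + (2 ℕ.* (suc j ℕ.* j) ℕ.+ suc j ℕ.* suc (suc j))          ≡⟨ ≡.cong +_ (factor j) ⟩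
  + (suc j ℕ.* (3 ℕ.* j ℕ.+ 2))        ≡⟨ ℤ.pos-* (suc j) (3 ℕ.* j ℕ.+ 2) ⟩
  + suc j ℤ.* (+ (3 ℕ.* j) ℤ.+ + 2)    ≡⟨ ≡.cong (λ i → + suc j ℤ.* (i ℤ.+ + 2)) (ℤ.pos-* 3 j) ⟩
  (+ 1 ℤ.+ + j) ℤ.* (+ 3 ℤ.* + j ℤ.+ + 2)    ≡⟨ negate (+ j) ⟩
  -[1+ j ] ℤ.* (+ 3 ℤ.* -[1+ j ] ℤ.+ + 1)    ∎
  where
  open ≡.≡-Reasoning
  double : ∀ j t → 2 ℕ.* (suc j ℕ.* j ℕ.+ t) ≡ 2 ℕ.* (suc j ℕ.* j) ℕ.+ (t ℕ.+ t)
  double = ℕ-solve-∀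
  factor : ∀ j → 2 ℕ.* (suc j ℕ.* j) ℕ.+ suc j ℕ.* suc (suc j) ≡ suc j ℕ.* (3 ℕ.* j ℕ.+ 2)
  factor = ℕ-solve-∀
  negate : ∀ x → (+ 1 ℤ.+ x) ℤ.* (+ 3 ℤ.* x ℤ.+ + 2) ≡ (ℤ.- (+ 1 ℤ.+ x)) ℤ.* (+ 3 ℤ.* (ℤ.- (+ 1 ℤ.+ x)) ℤ.+ + 1)
  negate = ℤ-solve-∀

IsOmega⇒≡ω : ∀ n m → IsOmega n m → n ≡ ω m
IsOmega⇒≡ω n m isω =
  ℤ.+-injective (ℤ.*-cancelˡ-≡ (+ 2) (+ n) (+ ω m) (≡.trans isω (≡.sym (ω-IsOmega m))))

-- m(3m+1) - m′(3m′+1) = (m - m′)(3(m+m′) + 1), and the last factor is 1 modulo 3.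
ω-injective : ∀ m m′ → ω m ≡ ω m′ → m ≡ m′
ω-injective m m′ eq with ℤ.i*j≡0⇒i≡0∨j≡0 (m ℤ.- m′) difference
  where
  open ≡.≡-Reasoning
  f : ℤ → ℤ
  f x = x ℤ.* (+ 3 ℤ.* x ℤ.+ + 1)
  factor : ∀ x y → (x ℤ.- y) ℤ.* (+ 3 ℤ.* (x ℤ.+ y) ℤ.+ + 1) ≡ x ℤ.* (+ 3 ℤ.* x ℤ.+ + 1) ℤ.- y ℤ.* (+ 3 ℤ.* y ℤ.+ + 1)
  factor = ℤ-solve-∀
  difference : (m ℤ.- m′) ℤ.* (+ 3 ℤ.* (m ℤ.+ m′) ℤ.+ + 1) ≡ + 0
  difference = begin
    (m ℤ.- m′) ℤ.* (+ 3 ℤ.* (m ℤ.+ m′) ℤ.+ + 1)  ≡⟨ factor m m′ ⟩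
    f m ℤ.- f m′                                 ≡⟨ ≡.cong₂ ℤ._-_ (ω-IsOmega m) (ω-IsOmega m′) ⟨
    + 2 ℤ.* + ω m ℤ.- + 2 ℤ.* + ω m′             ≡⟨ ≡.cong (λ w → + 2 ℤ.* + ω m ℤ.- + 2 ℤ.* + w) (≡.sym eq) ⟩
    + 2 ℤ.* + ω m ℤ.- + 2 ℤ.* + ω m              ≡⟨ ℤ.+-inverseʳ (+ 2 ℤ.* + ω m) ⟩
    + 0                                          ∎
... | inj₁ m-m′≡0 = ℤ.i-j≡0⇒i≡j m m′ m-m′≡0
... | inj₂ 3x+1≡0 = ⊥-elim (3≢1 (ℕ.m*n≡1⇒m≡1 3 ∣ m ℤ.+ m′ ∣ (begin
    3 ℕ.* ∣ m ℤ.+ m′ ∣              ≡⟨ ℤ.abs-* (+ 3) (m ℤ.+ m′) ⟨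
    ∣ + 3 ℤ.* (m ℤ.+ m′) ∣          ≡⟨ ≡.cong ∣_∣ (lemma (+ 3 ℤ.* (m ℤ.+ m′))) ⟩
    ∣ + 3 ℤ.* (m ℤ.+ m′) ℤ.+ + 1 ℤ.- + 1 ∣  ≡⟨ ≡.cong (λ i → ∣ i ℤ.- + 1 ∣) 3x+1≡0 ⟩
    1 ∎)))
  where
  open ≡.≡-Reasoning
  3≢1 : 3 ≢ 1
  3≢1 ()
  lemma : ∀ x → x ≡ x ℤ.+ + 1 ℤ.- + 1
  lemma = ℤ-solve-∀

k≤tri : ∀ k → k ≤ tri k
k≤tri zero    = z≤n
k≤tri (suc k) = ℕ.m≤n+m (suc k) (tri k)

∣m∣≤ω : ∀ m → ∣ m ∣ ≤ ω m
∣m∣≤ω (+ k)    = ℕ.≤-trans (k≤tri k) (ℕ.m≤n+m (tri k) (k ℕ.* k))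
∣m∣≤ω -[1+ j ] = ℕ.≤-trans (k≤tri (suc j)) (ℕ.m≤n+m (tri (suc j)) (suc j ℕ.* j))

-- Product identities in commutative rings

module RingIdentities {c ℓ} (R : CommutativeRing c ℓ) where
  open CommutativeRing R
  open import Algebra.Properties.Semiring.Exp semiring
  open import Algebra.Properties.CommutativeSemiring.Exp commutativeSemiring using (^-distrib-*)
  open import Algebra.Solver.Ring.NaturalCoefficients.Default commutativeSemiring using (solve; _:+_; _:*_; _:=_; con)
  open import Relation.Binary.Reasoning.Setoid setoid

  ε : Carrier
  ε = - 1#

  ε+1≈0 : ε + 1# ≈ 0#
  ε+1≈0 = -‿inverseˡ 1#

  [ε+1]*x+y≈y : ∀ x y → (ε + 1#) * x + y ≈ y
  [ε+1]*x+y≈y x y = begin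
    (ε + 1#) * x + y  ≈⟨ +-congʳ (*-congʳ ε+1≈0) ⟩
    0# * x + y        ≈⟨ +-congʳ (zeroˡ x) ⟩
    0# + y            ≈⟨ +-identityˡ y ⟩
    y                 ∎

  ε*ε≈1 : ε * ε ≈ 1#
  ε*ε≈1 = begin
    ε * ε                    ≈⟨ [ε+1]*x+y≈y 1# (ε * ε) ⟨
    (ε + 1#) * 1# + ε * ε    ≈⟨ solve 1 (λ e → (e :+ con 1) :* con 1 :+ e :* e := (e :+ con 1) :* e :+ con 1) refl ε ⟩
    (ε + 1#) * ε + 1#        ≈⟨ [ε+1]*x+y≈y ε 1# ⟩
    1#                       ∎

  ε^[k+k]≈1 : ∀ k → ε ^ (k ℕ.+ k) ≈ 1#
  ε^[k+k]≈1 zero    = refl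
  ε^[k+k]≈1 (suc k) = begin
    ε * ε ^ (k ℕ.+ suc k)    ≈⟨ *-congˡ (^-congʳ ε (ℕ.+-suc k k)) ⟩
    ε * (ε * ε ^ (k ℕ.+ k))  ≈⟨ *-assoc ε ε _ ⟨
    ε * ε * ε ^ (k ℕ.+ k)    ≈⟨ *-cong ε*ε≈1 (ε^[k+k]≈1 k) ⟩
    1# * 1#                  ≈⟨ *-identityˡ 1# ⟩
    1#                       ∎

  -- Subtraction is multiplication by ε, so that identities can be normalised by
  -- the semiring solver up to a multiple of ε + 1.
  1−_ : Carrier → Carrier
  1− x = 1# + ε * x

  1−-cong : ∀ {x y} → x ≈ y → 1− x ≈ 1− y
  1−-cong x≈y = +-congˡ (*-congˡ x≈y)

  [1−x][1+x] : ∀ x → (1− x) * (1# + x) ≈ 1− (x * x)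
  [1−x][1+x] x = begin
    (1− x) * (1# + x)                 ≈⟨ solve 2 (λ e x → (con 1 :+ e :* x) :* (con 1 :+ x) := (e :+ con 1) :* x :+ (con 1 :+ e :* (x :* x))) refl ε x ⟩
    (ε + 1#) * x + (1− (x * x))       ≈⟨ [ε+1]*x+y≈y x _ ⟩
    1− (x * x)                        ∎

  -- Meant for counting: prepending a fixed part any number of times gives a generating function
  -- with w = a + z w. The conclusion is w = a / (1 - z) with the denominator cleared.
  1−-quotient : ∀ {w a z} → w ≈ a + z * w → (1− z) * w ≈ a
  1−-quotient {w} {a} {z} w≈a+zw = begin
    (1− z) * w                     ≈⟨ solve 3 (λ e z w → (con 1 :+ e :* z) :* w := w :+ e :* (z :* w)) refl ε z w ⟩
    w + ε * (z * w)                ≈⟨ +-congʳ w≈a+zw ⟩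
    a + z * w + ε * (z * w)        ≈⟨ solve 3 (λ e a y → a :+ y :+ e :* y := (e :+ con 1) :* y :+ a) refl ε a (z * w) ⟩
    (ε + 1#) * (z * w) + a         ≈⟨ [ε+1]*x+y≈y (z * w) a ⟩
    a                              ∎

  ^-vanish : ∀ x {M N} → M ≤ N → x ^ M ≈ 0# → x ^ N ≈ 0#
  ^-vanish x {M} {N} M≤N x^M≈0 = begin
    x ^ N                  ≈⟨ ^-congʳ x (ℕ.m+[n∸m]≡n M≤N) ⟨
    x ^ (M ℕ.+ (N ∸ M))    ≈⟨ ^-homo-* x M (N ∸ M) ⟩
    x ^ M * x ^ (N ∸ M)    ≈⟨ *-congʳ x^M≈0 ⟩
    0# * x ^ (N ∸ M)       ≈⟨ zeroˡ _ ⟩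
    0#                     ∎

  -- ∏ x a k = (1 - x^(a+1)) ⋯ (1 - x^(a+k))
  ∏ : Carrier → ℕ → ℕ → Carrier
  ∏ x a zero    = 1#
  ∏ x a (suc k) = ∏ x a k * (1− (x ^ suc (a ℕ.+ k)))

  ∏-head : ∀ x a k → ∏ x a (suc k) ≈ (1− (x ^ suc a)) * ∏ x (suc a) k
  ∏-head x a zero = begin
    1# * (1− (x ^ suc (a ℕ.+ 0)))  ≈⟨ *-comm 1# _ ⟩
    (1− (x ^ suc (a ℕ.+ 0))) * 1#  ≈⟨ *-congʳ (1−-cong (^-congʳ x (≡.cong suc (ℕ.+-identityʳ a)))) ⟩
    (1− (x ^ suc a)) * 1#          ∎
  ∏-head x a (suc k) = begin
    ∏ x a (suc k) * (1− (x ^ suc (a ℕ.+ suc k)))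
      ≈⟨ *-cong (∏-head x a k) (1−-cong (^-congʳ x (≡.cong suc (ℕ.+-suc a k)))) ⟩
    (1− (x ^ suc a)) * ∏ x (suc a) k * (1− (x ^ suc (suc a ℕ.+ k)))
      ≈⟨ *-assoc _ _ _ ⟩
    (1− (x ^ suc a)) * ∏ x (suc a) (suc k) ∎

  -- Every exponent in the product is at least a + 1. In a truncated ring this makes the right-hand
  -- side of the finite form of Euler's identity equal to 1.
  ∏-vanish : ∀ x a k → x ^ suc a ≈ 0# → ∏ x a k ≈ 1#
  ∏-vanish x a zero    _ = refl
  ∏-vanish x a (suc k) x^a≈0 = begin
    ∏ x a k * (1− (x ^ suc (a ℕ.+ k)))
      ≈⟨ *-cong (∏-vanish x a k x^a≈0) (1−-cong (^-vanish x (s≤s (ℕ.m≤m+n a k)) x^a≈0)) ⟩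
    1# * (1# + ε * 0#)
      ≈⟨ solve 1 (λ e → con 1 :* (con 1 :+ e :* con 0) := con 1) refl ε ⟩
    1# ∎

  -- Shanks' identity

  shanks-term : Carrier → ℕ → ℕ → Carrier
  shanks-term x n s = ε ^ s * (∏ x s (n ∸ s) * x ^ (s ℕ.* n ℕ.+ tri s))

  shanks-sum : Carrier → ℕ → ℕ → Carrier
  shanks-sum x n zero    = 0#
  shanks-sum x n (suc j) = shanks-sum x n j + shanks-term x n j

  -- The defect of the telescoping: the partial sum over s < j for n minus the one for n + 1. At j =
  -- n + 1 its product is empty, and a power with exponent ω(-(n+1)) is left, up to sign.
  shanks-boundary : Carrier → ℕ → ℕ → Carrier
  shanks-boundary x n zero    = 0#
  shanks-boundary x n (suc j) = ε ^ j * (∏ x j (n ∸ j) * x ^ (suc j ℕ.* n ℕ.+ tri (suc j)))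

  ∏-extend : ∀ x {s n} → s ≤ n → ∏ x s (suc n ∸ s) ≈ ∏ x s (n ∸ s) * (1− (x ^ suc n))
  ∏-extend x {s} {n} s≤n = begin
    ∏ x s (suc n ∸ s)                              ≡⟨ ≡.cong (∏ x s) (ℕ.+-∸-assoc 1 s≤n) ⟩
    ∏ x s (n ∸ s) * (1− (x ^ suc (s ℕ.+ (n ∸ s)))) ≈⟨ *-congˡ (1−-cong (^-congʳ x (≡.cong suc (ℕ.m+[n∸m]≡n s≤n)))) ⟩
    ∏ x s (n ∸ s) * (1− (x ^ suc n))               ∎

  -- For j = i + 1 both sides collapse to `ε * E * r * z * u`. On the left, passing from n to n + 1
  -- brings in u and 1 - w, and the boundary term restores what w removed. On the right, the
  -- boundary term carries the additional factor 1 - u, whose 1 cancels the summand for n.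
  shanks-step : ∀ x n j → j ≤ n →
    shanks-term x (suc n) j + shanks-boundary x n (suc j) ≈ shanks-term x n j + shanks-boundary x n j
  shanks-step x n zero _ = begin
    1# * (∏ x 0 n * (1− w) * 1#) + 1# * (∏ x 0 n * x ^ (n ℕ.+ 0 ℕ.+ 1))
      ≈⟨ +-congˡ (*-congˡ (*-congˡ (^-congʳ x (exponent n)))) ⟩
    1# * (∏ x 0 n * (1− w) * 1#) + 1# * (∏ x 0 n * w)
      ≈⟨ solve 3 (λ e r w → con 1 :* (r :* (con 1 :+ e :* w) :* con 1) :+ con 1 :* (r :* w)
           := (e :+ con 1) :* (r :* w) :+ (con 1 :* (r :* con 1) :+ con 0)) refl ε (∏ x 0 n) w ⟩
    (ε + 1#) * (∏ x 0 n * w) + (1# * (∏ x 0 n * 1#) + 0#)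
      ≈⟨ [ε+1]*x+y≈y _ _ ⟩
    1# * (∏ x 0 n * 1#) + 0# ∎
    where
    w = x ^ suc n
    exponent : ∀ n → n ℕ.+ 0 ℕ.+ 1 ≡ suc n
    exponent = ℕ-solve-∀
  shanks-step x n (suc i) i<n = begin
    ε * E * (∏ x (suc i) (suc n ∸ suc i) * x ^ (suc i ℕ.* suc n ℕ.+ tri (suc i)))
      + ε * E * (r * x ^ (suc (suc i) ℕ.* n ℕ.+ tri (suc (suc i))))
      ≈⟨ +-cong (*-congˡ (*-cong (∏-extend x i<n) zu)) (*-congˡ (*-congˡ zuw)) ⟩
    ε * E * (r * (1− w) * (z * u)) + ε * E * (r * (z * (u * w)))
      ≈⟨ solve 6 (λ e E r z u w →
           e :* E :* (r :* (con 1 :+ e :* w) :* (z :* u)) :+ e :* E :* (r :* (z :* (u :* w)))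
           := (e :+ con 1) :* (e :* E :* r :* z :* u :* w) :+ e :* E :* r :* z :* u)
           refl ε E r z u w ⟩
    (ε + 1#) * (ε * E * r * z * u * w) + ε * E * r * z * u
      ≈⟨ [ε+1]*x+y≈y _ _ ⟩
    ε * E * r * z * u
      -- Now the right-hand side is rebuilt: of the inserted multiple of ε + 1, the ε part is the
      -- summand for n, and the 1 part completes u to 1 - u in the boundary term.
      ≈⟨ [ε+1]*x+y≈y (E * r * z) _ ⟨
    (ε + 1#) * (E * r * z) + ε * E * r * z * u
      ≈⟨ solve 5 (λ e E r z u →
           (e :+ con 1) :* (E :* r :* z) :+ e :* E :* r :* z :* u
           := e :* E :* (r :* z) :+ E :* ((con 1 :+ e :* u) :* r :* z))
           refl ε E r z u ⟩
    ε * E * (r * z) + E * ((1− u) * r * z)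
      ≈⟨ +-congˡ (*-congˡ (*-congʳ (∏-head x i (n ∸ suc i)))) ⟨
    ε * E * (r * z) + E * (∏ x i (suc (n ∸ suc i)) * z)
      ≡⟨ ≡.cong (λ k → ε * E * (r * z) + E * (∏ x i k * z)) (≡.sym (ℕ.+-∸-assoc 1 i<n)) ⟩
    ε * E * (r * z) + E * (∏ x i (n ∸ i) * z) ∎
    where
    E = ε ^ i
    r = ∏ x (suc i) (n ∸ suc i)
    z = x ^ (suc i ℕ.* n ℕ.+ tri (suc i))
    u = x ^ suc i
    w = x ^ suc n
    zu-exponent : ∀ i n t → suc i ℕ.* suc n ℕ.+ t ≡ (suc i ℕ.* n ℕ.+ t) ℕ.+ suc i
    zu-exponent = ℕ-solve-∀
    zuw-exponent : ∀ i n t → suc (suc i) ℕ.* n ℕ.+ (t ℕ.+ suc (suc i)) ≡ (suc i ℕ.* n ℕ.+ t) ℕ.+ (suc i ℕ.+ suc n)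
    zuw-exponent = ℕ-solve-∀
    zu : x ^ (suc i ℕ.* suc n ℕ.+ tri (suc i)) ≈ z * u
    zu = trans (^-congʳ x (zu-exponent i n (tri (suc i)))) (^-homo-* x (suc i ℕ.* n ℕ.+ tri (suc i)) (suc i))
    zuw : x ^ (suc (suc i) ℕ.* n ℕ.+ tri (suc (suc i))) ≈ z * (u * w)
    zuw = begin
      x ^ (suc (suc i) ℕ.* n ℕ.+ tri (suc (suc i)))  ≈⟨ ^-congʳ x (zuw-exponent i n (tri (suc i))) ⟩
      x ^ ((suc i ℕ.* n ℕ.+ tri (suc i)) ℕ.+ (suc i ℕ.+ suc n)) ≈⟨ ^-homo-* x (suc i ℕ.* n ℕ.+ tri (suc i)) (suc i ℕ.+ suc n) ⟩
      z * x ^ (suc i ℕ.+ suc n)                      ≈⟨ *-congˡ (^-homo-* x (suc i) (suc n)) ⟩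
      z * (u * w)                                    ∎

  shanks-telescope : ∀ x n j → j ≤ suc n →
    shanks-sum x (suc n) j + shanks-boundary x n j ≈ shanks-sum x n j
  shanks-telescope x n zero    _ = +-identityˡ 0#
  shanks-telescope x n (suc j) (s≤s j≤n) = begin
    shanks-sum x (suc n) j + shanks-term x (suc n) j + shanks-boundary x n (suc j)
      ≈⟨ +-assoc _ _ _ ⟩
    shanks-sum x (suc n) j + (shanks-term x (suc n) j + shanks-boundary x n (suc j))
      ≈⟨ +-congˡ (shanks-step x n j j≤n) ⟩
    shanks-sum x (suc n) j + (shanks-term x n j + shanks-boundary x n j)
      ≈⟨ solve 3 (λ a b c → a :+ (b :+ c) := (a :+ c) :+ b) refl _ _ _ ⟩
    shanks-sum x (suc n) j + shanks-boundary x n j + shanks-term x n j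
      ≈⟨ +-congʳ (shanks-telescope x n j (ℕ.m≤n⇒m≤1+n j≤n)) ⟩
    shanks-sum x n (suc j) ∎

  pentagonal-sum : Carrier → ℕ → Carrier
  pentagonal-sum x zero    = 1#
  pentagonal-sum x (suc n) =
    pentagonal-sum x n + (ε ^ suc n * x ^ ω -[1+ n ] + ε ^ suc n * x ^ ω (+ suc n))

  ∏-empty : ∀ x n → ∏ x n (n ∸ n) ≈ 1#
  ∏-empty x n = reflexive (≡.cong (∏ x n) (ℕ.n∸n≡0 n))

  -- Induction on n. The summands with s ≤ n change by the boundary term B, whose negative is the
  -- pentagonal term at m = -(n+1); the new summand s = n + 1 has an empty product and is the term
  -- at m = n + 1.
  shanks : ∀ x n → shanks-sum x n (suc n) ≈ pentagonal-sum x n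
  shanks x zero    = solve 0 (con 0 :+ con 1 :* (con 1 :* con 1) := con 1) refl
  shanks x (suc n) = begin
    S + T                        ≈⟨ [ε+1]*x+y≈y B _ ⟨
    (ε + 1#) * B + (S + T)       ≈⟨ solve 4 (λ e S B T → (e :+ con 1) :* B :+ (S :+ T) := (S :+ B) :+ (e :* B :+ T)) refl ε S B T ⟩
    (S + B) + (ε * B + T)        ≈⟨ +-cong (trans (shanks-telescope x n (suc n) ℕ.≤-refl) (shanks x n)) (+-cong εB T≈) ⟩
    pentagonal-sum x (suc n)     ∎
    where
    S = shanks-sum x (suc n) (suc n)
    T = shanks-term x (suc n) (suc n)
    B = shanks-boundary x n (suc n)
    εB : ε * B ≈ ε ^ suc n * x ^ ω -[1+ n ]
    εB = begin
      ε * (ε ^ n * (∏ x n (n ∸ n) * x ^ ω -[1+ n ]))  ≈⟨ *-congˡ (*-congˡ (*-congʳ (∏-empty x n))) ⟩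
      ε * (ε ^ n * (1# * x ^ ω -[1+ n ]))             ≈⟨ solve 3 (λ e E w → e :* (E :* (con 1 :* w)) := e :* E :* w) refl ε (ε ^ n) _ ⟩
      ε ^ suc n * x ^ ω -[1+ n ]                      ∎
    T≈ : T ≈ ε ^ suc n * x ^ ω (+ suc n)
    T≈ = *-congˡ (trans (*-congʳ (∏-empty x (suc n))) (*-identityˡ _))

  shanks-sum-vanish : ∀ x n j → x ^ suc n ≈ 0# → shanks-sum x n (suc j) ≈ ∏ x 0 n
  shanks-sum-vanish x n zero    _ = solve 1 (λ r → con 0 :+ con 1 :* (r :* con 1) := r) refl _
  shanks-sum-vanish x n (suc j) x^n≈0 = begin
    shanks-sum x n (suc j) + ε ^ suc j * (r * x ^ (suc j ℕ.* n ℕ.+ tri (suc j)))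
      ≈⟨ +-cong (shanks-sum-vanish x n j x^n≈0) (*-congˡ (*-congˡ (^-vanish x exponent x^n≈0))) ⟩
    ∏ x 0 n + ε ^ suc j * (r * 0#)
      ≈⟨ solve 3 (λ p e r → p :+ e :* (r :* con 0) := p) refl _ _ _ ⟩
    ∏ x 0 n ∎
    where
    r = ∏ x (suc j) (n ∸ suc j)
    -- For s = j + 1 the product s n contributes at least n and `tri s` at least 1, which is just
    -- enough to pass the truncation.
    exponent : suc n ≤ suc j ℕ.* n ℕ.+ tri (suc j)
    exponent = ℕ.≤-trans (ℕ.≤-reflexive (≡.sym (ℕ.+-comm n 1)))
      (ℕ.+-mono-≤ (ℕ.m≤m+n n (j ℕ.* n)) (ℕ.≤-trans (s≤s z≤n) (ℕ.m≤n+m (suc j) (tri j))))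

  pentagonal : ∀ x n → x ^ suc n ≈ 0# → ∏ x 0 n ≈ pentagonal-sum x n
  pentagonal x n x^n≈0 = trans (sym (shanks-sum-vanish x n n x^n≈0)) (shanks x n)

  -- Euler's odd-distinct identity

  odd-∏ : Carrier → ℕ → Carrier
  odd-∏ y zero    = 1#
  odd-∏ y (suc k) = odd-∏ y k * (1− (y ^ suc (k ℕ.+ k)))

  distinct-∏ : Carrier → ℕ → Carrier
  distinct-∏ y zero    = 1#
  distinct-∏ y (suc k) = distinct-∏ y k * (1# + y ^ suc k)

  -- With finitely many factors the product is not 1 but runs over k < i ≤ 2k. Passing to k + 1, the
  -- odd product appends the factor at 2k + 1, and 1 + v turns the head factor 1 - y^(k+1) into the
  -- factor at 2k + 2.
  euler : ∀ y k → distinct-∏ y k * odd-∏ y k ≈ ∏ y k k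
  euler y zero    = *-identityˡ 1#
  euler y (suc k) = begin
    distinct-∏ y k * (1# + v) * (odd-∏ y k * (1− t))
      ≈⟨ solve 4 (λ d v o t → d :* v :* (o :* t) := (d :* o) :* t :* v) refl (distinct-∏ y k) (1# + v) (odd-∏ y k) (1− t) ⟩
    distinct-∏ y k * odd-∏ y k * (1− t) * (1# + v)
      ≈⟨ *-congʳ (*-congʳ (euler y k)) ⟩
    ∏ y k (suc k) * (1# + v)
      ≈⟨ *-congʳ (∏-head y k k) ⟩
    (1− v) * ∏ y (suc k) k * (1# + v)
      ≈⟨ solve 3 (λ a b c → a :* b :* c := b :* (a :* c)) refl (1− v) (∏ y (suc k) k) (1# + v) ⟩
    ∏ y (suc k) k * ((1− v) * (1# + v))
      ≈⟨ *-congˡ ([1−x][1+x] v) ⟩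
    ∏ y (suc k) k * (1− (v * v))
      ≈⟨ *-congˡ (1−-cong (trans (sym (^-homo-* y (suc k) (suc k))) (^-congʳ y (≡.cong suc (ℕ.+-suc k k))))) ⟩
    ∏ y (suc k) (suc k) ∎
    where
    v = y ^ suc k
    t = y ^ suc (k ℕ.+ k)

  -- The factors pair up according to the parity of i.
  ∏-q*∏-−q : ∀ q k →
    ∏ q 0 (k ℕ.+ k) * ∏ (ε * q) 0 (k ℕ.+ k) ≈ odd-∏ (q * q) k * (∏ (q * q) 0 k * ∏ (q * q) 0 k)
  ∏-q*∏-−q q zero    = sym (*-congˡ (*-identityˡ 1#))
  ∏-q*∏-−q q (suc k) = begin
    ∏ q 0 (suc k ℕ.+ suc k) * ∏ p 0 (suc k ℕ.+ suc k)
      ≡⟨ ≡.cong (λ i → ∏ q 0 (suc i) * ∏ p 0 (suc i)) (ℕ.+-suc k k) ⟩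
    ∏ q 0 (k ℕ.+ k) * (1− a) * (1− (q * a)) * (∏ p 0 (k ℕ.+ k) * (1− (p ^ suc (k ℕ.+ k))) * (1− (p ^ suc (suc (k ℕ.+ k)))))
      -- At the odd exponent 2k + 1 the sign survives, and 1 - a meets 1 + a; at the even exponent
      -- 2k + 2 it disappears, and 1 - b occurs twice.
      ≈⟨ *-cong (*-congˡ (1−-cong q*a)) (*-cong (*-congˡ (trans (1−-cong pa) 1−εa)) (1−-cong pb)) ⟩
    ∏ q 0 (k ℕ.+ k) * (1− a) * (1− b) * (∏ p 0 (k ℕ.+ k) * (1# + a) * (1− b))
      ≈⟨ solve 5 (λ P P' A A' B → P :* A :* B :* (P' :* A' :* B) := (P :* P') :* (A :* A') :* (B :* B)) refl
           (∏ q 0 (k ℕ.+ k)) (∏ p 0 (k ℕ.+ k)) (1− a) (1# + a) (1− b) ⟩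
    ∏ q 0 (k ℕ.+ k) * ∏ p 0 (k ℕ.+ k) * ((1− a) * (1# + a)) * ((1− b) * (1− b))
      ≈⟨ *-congʳ (*-cong (∏-q*∏-−q q k) (trans ([1−x][1+x] a) (1−-cong (sym (^-distrib-* q q (suc (k ℕ.+ k))))))) ⟩
    odd-∏ y k * (∏ y 0 k * ∏ y 0 k) * (1− (y ^ suc (k ℕ.+ k))) * ((1− b) * (1− b))
      ≈⟨ solve 4 (λ o d t b → o :* (d :* d) :* t :* (b :* b) := (o :* t) :* ((d :* b) :* (d :* b))) refl
           (odd-∏ y k) (∏ y 0 k) (1− (y ^ suc (k ℕ.+ k))) (1− b) ⟩
    odd-∏ y (suc k) * (∏ y 0 (suc k) * ∏ y 0 (suc k)) ∎
    where
    y = q * q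
    p = ε * q
    a = q ^ suc (k ℕ.+ k)
    b = y ^ suc k
    q*a : q * a ≈ b
    q*a = begin
      q ^ suc (suc (k ℕ.+ k))    ≈⟨ ^-congʳ q (≡.cong suc (ℕ.+-suc k k)) ⟨
      q ^ (suc k ℕ.+ suc k)      ≈⟨ ^-homo-* q (suc k) (suc k) ⟩
      q ^ suc k * q ^ suc k      ≈⟨ ^-distrib-* q q (suc k) ⟨
      b                          ∎
    pa : p ^ suc (k ℕ.+ k) ≈ ε * a
    pa = begin
      p ^ suc (k ℕ.+ k)           ≈⟨ ^-distrib-* ε q (suc (k ℕ.+ k)) ⟩
      ε * ε ^ (k ℕ.+ k) * a       ≈⟨ *-congʳ (*-congˡ (ε^[k+k]≈1 k)) ⟩
      ε * 1# * a                  ≈⟨ *-congʳ (*-identityʳ ε) ⟩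
      ε * a                       ∎
    1−εa : 1− (ε * a) ≈ 1# + a
    1−εa = +-congˡ (trans (sym (*-assoc ε ε a)) (trans (*-congʳ ε*ε≈1) (*-identityˡ a)))
    pb : p ^ suc (suc (k ℕ.+ k)) ≈ b
    pb = begin
      ε * q * p ^ suc (k ℕ.+ k)   ≈⟨ *-congˡ pa ⟩
      ε * q * (ε * a)             ≈⟨ solve 3 (λ e q a → e :* q :* (e :* a) := e :* e :* (q :* a)) refl ε q a ⟩
      ε * ε * (q * a)             ≈⟨ *-cong ε*ε≈1 q*a ⟩
      1# * b                      ≈⟨ *-identityˡ b ⟩
      b                           ∎

  -- Cancelling 1 - z for nilpotent z

  fixed-by-nilpotent : ∀ {z x} n → z ^ n ≈ 0# → x ≈ z * x → x ≈ 0#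
  fixed-by-nilpotent {z} {x} n z^n≈0 x≈zx = begin
    x          ≈⟨ iterate n ⟩
    z ^ n * x  ≈⟨ *-congʳ z^n≈0 ⟩
    0# * x     ≈⟨ zeroˡ x ⟩
    0#         ∎
    where
    iterate : ∀ n → x ≈ z ^ n * x
    iterate zero    = sym (*-identityˡ x)
    iterate (suc n) = begin
      x                ≈⟨ x≈zx ⟩
      z * x            ≈⟨ *-congˡ (iterate n) ⟩
      z * (z ^ n * x)  ≈⟨ *-assoc z _ x ⟨
      z ^ suc n * x    ∎

  -- Instead of inverting 1 - z by a geometric series, the hypothesis is read as x - y = z (x - y).
  -- Iterating this n times multiplies the difference by z^n = 0.
  1−-cancelˡ : ∀ {z x y} n → z ^ n ≈ 0# → (1− z) * x ≈ (1− z) * y → x ≈ y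
  1−-cancelˡ {z} {x} {y} n z^n≈0 eq = begin
    x                          ≈⟨ +-identityˡ x ⟨
    0# + x                     ≈⟨ +-congʳ y+εy ⟨
    y + ε * y + x              ≈⟨ solve 3 (λ e x y → y :+ e :* y :+ x := (x :+ e :* y) :+ y) refl ε x y ⟩
    x + ε * y + y              ≈⟨ +-congʳ (fixed-by-nilpotent n z^n≈0 fixed) ⟩
    0# + y                     ≈⟨ +-identityˡ y ⟩
    y                          ∎
    where
    y+εy : y + ε * y ≈ 0#
    y+εy = trans (solve 2 (λ e y → y :+ e :* y := (e :+ con 1) :* y :+ con 0) refl ε y) ([ε+1]*x+y≈y y 0#)
    fixed : x + ε * y ≈ z * (x + ε * y)
    fixed = begin
      x + ε * y
        ≈⟨ [ε+1]*x+y≈y (z * x) _ ⟨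
      (ε + 1#) * (z * x) + (x + ε * y)
        ≈⟨ solve 4 (λ e x y z → (e :+ con 1) :* (z :* x) :+ (x :+ e :* y) := (con 1 :+ e :* z) :* x :+ (z :* x :+ e :* y)) refl ε x y z ⟩
      (1− z) * x + (z * x + ε * y)
        ≈⟨ +-congʳ eq ⟩
      (1− z) * y + (z * x + ε * y)
        ≈⟨ solve 4 (λ e x y z → (con 1 :+ e :* z) :* y :+ (z :* x :+ e :* y) := (e :+ con 1) :* y :+ z :* (x :+ e :* y)) refl ε x y z ⟩
      (ε + 1#) * y + z * (x + ε * y)
        ≈⟨ [ε+1]*x+y≈y y _ ⟩
      z * (x + ε * y) ∎

  ∏-cancelˡ : ∀ q {a b} n k → q ^ n ≈ 0# → ∏ q 0 k * a ≈ ∏ q 0 k * b → a ≈ b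
  ∏-cancelˡ q {a} {b} n zero    _ eq = trans (sym (*-identityˡ a)) (trans eq (*-identityˡ b))
  ∏-cancelˡ q {a} {b} n (suc k) q^n≈0 eq =
    1−-cancelˡ n nilpotent (∏-cancelˡ q n k q^n≈0 (trans (sym (*-assoc _ _ a)) (trans eq (*-assoc _ _ b))))
    where
    nilpotent : (q ^ suc k) ^ n ≈ 0#
    nilpotent = trans (^-assocʳ q (suc k) n) (^-vanish q (ℕ.m≤m+n n (k ℕ.* n)) q^n≈0)

  -- The series of d₂ in characteristic dividing 4

  module _ (4≈0 : 1# + 1# + 1# + 1# ≈ 0#) where

    -- The two squares differ by 4x; in the computation this appears as 2ε = 2. It is the step that
    -- ties the theorem to the modulus 4.
    [1−x]²≈[1+x]² : ∀ x → (1− x) * (1− x) ≈ (1# + x) * (1# + x)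
    [1−x]²≈[1+x]² x = begin
      (1− x) * (1− x)
        ≈⟨ solve 2 (λ e x → (con 1 :+ e :* x) :* (con 1 :+ e :* x) := con 1 :+ (con 1 :+ con 1) :* e :* x :+ e :* e :* (x :* x)) refl ε x ⟩
      1# + (1# + 1#) * ε * x + ε * ε * (x * x)
        ≈⟨ +-cong (+-congˡ (*-congʳ 2ε≈2)) (*-congʳ ε*ε≈1) ⟩
      1# + (1# + 1#) * x + 1# * (x * x)
        ≈⟨ solve 1 (λ x → con 1 :+ (con 1 :+ con 1) :* x :+ con 1 :* (x :* x) := (con 1 :+ x) :* (con 1 :+ x)) refl x ⟩
      (1# + x) * (1# + x) ∎
      where
      2ε≈2 : (1# + 1#) * ε ≈ 1# + 1#
      2ε≈2 = begin
        (1# + 1#) * ε                           ≈⟨ +-identityˡ _ ⟨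
        0# + (1# + 1#) * ε                      ≈⟨ +-congʳ 4≈0 ⟨
        1# + 1# + 1# + 1# + (1# + 1#) * ε       ≈⟨ solve 1 (λ e → con 1 :+ con 1 :+ con 1 :+ con 1 :+ (con 1 :+ con 1) :* e := (e :+ con 1) :* (con 1 :+ con 1) :+ (con 1 :+ con 1)) refl ε ⟩
        (ε + 1#) * (1# + 1#) + (1# + 1#) ≈⟨ [ε+1]*x+y≈y _ _ ⟩
        1# + 1#                                 ∎

    ∏²≈distinct-∏² : ∀ y k → ∏ y 0 k * ∏ y 0 k ≈ distinct-∏ y k * distinct-∏ y k
    ∏²≈distinct-∏² y zero    = refl
    ∏²≈distinct-∏² y (suc k) = begin
      ∏ y 0 k * (1− v) * (∏ y 0 k * (1− v))                            ≈⟨ interchange _ _ ⟩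
      ∏ y 0 k * ∏ y 0 k * ((1− v) * (1− v))                            ≈⟨ *-cong (∏²≈distinct-∏² y k) ([1−x]²≈[1+x]² v) ⟩
      distinct-∏ y k * distinct-∏ y k * ((1# + v) * (1# + v))          ≈⟨ interchange _ _ ⟨
      distinct-∏ y k * (1# + v) * (distinct-∏ y k * (1# + v))          ∎
      where
      v = y ^ suc k
      interchange : ∀ a b → a * b * (a * b) ≈ a * a * (b * b)
      interchange = solve 2 (λ a b → a :* b :* (a :* b) := a :* a :* (b :* b)) refl

    -- Here A stands for the truncated generating function of d₂, given through its product with the
    -- denominator. Both sides are compared after multiplication by that denominator, which is then
    -- cancelled. The denominator has 2k factors so that it splits evenly into k odd and k even
    -- exponents, leaving products in y = q² up to k.
    overpartition-series : ∀ q k {A} → q ^ suc k ≈ 0# →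
      ∏ q 0 (k ℕ.+ k) * A ≈ distinct-∏ (q * q) k → A ≈ pentagonal-sum (ε * q) (k ℕ.+ k)
    overpartition-series q k {A} q^k≈0 eq = ∏-cancelˡ q (suc k) (k ℕ.+ k) q^k≈0 (begin
      ∏ q 0 (k ℕ.+ k) * A                                     ≈⟨ eq ⟩
      distinct-∏ y k                                          ≈⟨ *-identityˡ _ ⟨
      1# * distinct-∏ y k                                     ≈⟨ *-congʳ (∏-vanish y k k y^k≈0) ⟨
      ∏ y k k * distinct-∏ y k                                ≈⟨ *-congʳ (euler y k) ⟨
      distinct-∏ y k * odd-∏ y k * distinct-∏ y k             ≈⟨ solve 2 (λ d o → d :* o :* d := o :* (d :* d)) refl _ _ ⟩
      odd-∏ y k * (distinct-∏ y k * distinct-∏ y k)           ≈⟨ *-congˡ (∏²≈distinct-∏² y k) ⟨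
      odd-∏ y k * (∏ y 0 k * ∏ y 0 k)                         ≈⟨ ∏-q*∏-−q q k ⟨
      ∏ q 0 (k ℕ.+ k) * ∏ (ε * q) 0 (k ℕ.+ k)                 ≈⟨ *-congˡ (pentagonal (ε * q) (k ℕ.+ k) p^2k≈0) ⟩
      ∏ q 0 (k ℕ.+ k) * pentagonal-sum (ε * q) (k ℕ.+ k)      ∎)
      where
      y = q * q
      y^k≈0 : y ^ suc k ≈ 0#
      y^k≈0 = trans (^-distrib-* q q (suc k)) (trans (*-congʳ q^k≈0) (zeroˡ _))
      p^2k≈0 : (ε * q) ^ suc (k ℕ.+ k) ≈ 0#
      p^2k≈0 = trans (^-distrib-* ε q (suc (k ℕ.+ k)))
        (trans (*-congˡ (^-vanish q (s≤s (ℕ.m≤m+n k k)) q^k≈0)) (zeroʳ _))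

  -- The exponent of the sign is m(m+1)/2, which is `tri n` at m = -(n+1) and `tri (suc n)` at m = n
  -- + 1.
  signed-pentagonal-sum : Carrier → ℕ → Carrier
  signed-pentagonal-sum q zero    = 1#
  signed-pentagonal-sum q (suc n) =
    signed-pentagonal-sum q n + (ε ^ tri n * q ^ ω -[1+ n ] + ε ^ tri (suc n) * q ^ ω (+ suc n))

  -- The signs (-1)^m and (-1)^(ω m) combine: |m| + ω m equals m(m+1)/2 plus twice `tri (suc n)`,
  -- for |m| = n + 1, and the even part drops out of the power of ε.
  pentagonal-sum-−q : ∀ q n → pentagonal-sum (ε * q) n ≈ signed-pentagonal-sum q n
  pentagonal-sum-−q q zero    = refl
  pentagonal-sum-−q q (suc n) =
    +-cong (pentagonal-sum-−q q n)
      (+-cong (absorb (tri (suc n)) (tri n) (suc n) (ω -[1+ n ]) negative)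
              (absorb (tri (suc n)) (tri (suc n)) (suc n) (ω (+ suc n)) positive))
    where
    absorb : ∀ h t k w → k ℕ.+ w ≡ (h ℕ.+ h) ℕ.+ t → ε ^ k * (ε * q) ^ w ≈ ε ^ t * q ^ w
    absorb h t k w eq = begin
      ε ^ k * (ε * q) ^ w         ≈⟨ *-congˡ (^-distrib-* ε q w) ⟩
      ε ^ k * (ε ^ w * q ^ w)     ≈⟨ *-assoc _ _ _ ⟨
      ε ^ k * ε ^ w * q ^ w       ≈⟨ *-congʳ (^-homo-* ε k w) ⟨
      ε ^ (k ℕ.+ w) * q ^ w       ≈⟨ *-congʳ (^-congʳ ε eq) ⟩
      ε ^ (h ℕ.+ h ℕ.+ t) * q ^ w ≈⟨ *-congʳ (^-homo-* ε (h ℕ.+ h) t) ⟩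
      ε ^ (h ℕ.+ h) * ε ^ t * q ^ w ≈⟨ *-congʳ (*-congʳ (ε^[k+k]≈1 h)) ⟩
      1# * ε ^ t * q ^ w          ≈⟨ *-congʳ (*-identityˡ _) ⟩
      ε ^ t * q ^ w               ∎
    negative : suc n ℕ.+ ω -[1+ n ] ≡ (tri (suc n) ℕ.+ tri (suc n)) ℕ.+ tri n
    negative = ≡.trans (lemma n (tri n)) (≡.cong (ℕ._+ tri n) (≡.sym (2*tri (suc n))))
      where
      lemma : ∀ n t → suc n ℕ.+ (suc n ℕ.* n ℕ.+ (t ℕ.+ suc n)) ≡ suc n ℕ.* suc (suc n) ℕ.+ t
      lemma = ℕ-solve-∀
    positive : suc n ℕ.+ ω (+ suc n) ≡ (tri (suc n) ℕ.+ tri (suc n)) ℕ.+ tri (suc n)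
    positive = ≡.trans (lemma n (tri (suc n))) (≡.cong (ℕ._+ tri (suc n)) (≡.sym (2*tri (suc n))))
      where
      lemma : ∀ n t → suc n ℕ.+ (suc n ℕ.* suc n ℕ.+ t) ≡ suc n ℕ.* suc (suc n) ℕ.+ t
      lemma = ℕ-solve-∀

-- Power series modulo 4

infix 4 _≡₄_
-- Wrapped in a record so that both numbers can be inferred from the type of a proof, which a bare
-- equation between remainders does not allow.
record _≡₄_ (x y : ℕ) : Set where
  constructor mod₄
  field %₄ : x % 4 ≡ y % 4
open _≡₄_

≡⇒≡₄ : ∀ {x y} → x ≡ y → x ≡₄ y
≡⇒≡₄ x≡y = mod₄ (≡.cong (_% 4) x≡y)

-- Negation is x ↦ 3x, so that lengths of lists embed as they are.
ℕ/4 : CommutativeRing 0ℓ 0ℓ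
ℕ/4 = record
  { Carrier = ℕ
  ; _≈_     = _≡₄_
  ; _+_     = ℕ._+_
  ; _*_     = ℕ._*_
  ; -_      = 3 ℕ.*_
  ; 0#      = 0
  ; 1#      = 1
  ; isCommutativeRing = record
    { isRing = record
      { +-isAbelianGroup = record
        { isGroup = record
          { isMonoid = record
            { isSemigroup = record
              { isMagma = record
                { isEquivalence = record
                  { refl  = mod₄ ≡.refl
                  ; sym   = λ (mod₄ p) → mod₄ (≡.sym p)
                  ; trans = λ (mod₄ p) (mod₄ r) → mod₄ (≡.trans p r)
                  }
                ; ∙-cong = +-cong₄
                }
              ; assoc = λ x y z → ≡⇒≡₄ (ℕ.+-assoc x y z)
              }
            ; identity = (λ _ → mod₄ ≡.refl) , ≡⇒≡₄ ∘ ℕ.+-identityʳ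
            }
          ; inverse = (λ x → mod₄ (3x+x≈0 x)) , λ x → mod₄ (≡.trans (≡.cong (_% 4) (ℕ.+-comm x (3 ℕ.* x))) (3x+x≈0 x))
          ; ⁻¹-cong = *-cong₄ {3} {3} (mod₄ ≡.refl)
          }
        ; comm = λ x y → ≡⇒≡₄ (ℕ.+-comm x y)
        }
      ; *-cong     = *-cong₄
      ; *-assoc    = λ x y z → ≡⇒≡₄ (ℕ.*-assoc x y z)
      ; *-identity = ≡⇒≡₄ ∘ ℕ.*-identityˡ , ≡⇒≡₄ ∘ ℕ.*-identityʳ
      ; distrib    = (λ x y z → ≡⇒≡₄ (ℕ.*-distribˡ-+ x y z)) , λ x y z → ≡⇒≡₄ (ℕ.*-distribʳ-+ x y z)
      }
    ; *-comm = λ x y → ≡⇒≡₄ (ℕ.*-comm x y)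
    }
  }
  where
  +-cong₄ : ∀ {x y u v} → x ≡₄ y → u ≡₄ v → x ℕ.+ u ≡₄ y ℕ.+ v
  +-cong₄ {x} {y} {u} {v} (mod₄ p) (mod₄ r) = mod₄ (≡.trans (%-distribˡ-+ x u 4)
    (≡.trans (≡.cong₂ (λ a b → (a ℕ.+ b) % 4) p r) (≡.sym (%-distribˡ-+ y v 4))))
  *-cong₄ : ∀ {x y u v} → x ≡₄ y → u ≡₄ v → x ℕ.* u ≡₄ y ℕ.* v
  *-cong₄ {x} {y} {u} {v} (mod₄ p) (mod₄ r) = mod₄ (≡.trans (%-distribˡ-* x u 4)
    (≡.trans (≡.cong₂ (λ a b → (a ℕ.* b) % 4) p r) (≡.sym (%-distribˡ-* y v 4))))
  3x+x≈0 : ∀ x → (3 ℕ.* x ℕ.+ x) % 4 ≡ 0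
  3x+x≈0 x = ≡.trans (≡.cong (_% 4) (≡.trans (ℕ.+-comm (3 ℕ.* x) x) (ℕ.*-comm 4 x))) (m*n%n≡0 x 4)

module PowerSeries {c ℓ} (R : CommutativeRing c ℓ) where
  open CommutativeRing R
  open import Algebra.Solver.Ring.NaturalCoefficients.Default commutativeSemiring using (solve; _:+_; _:*_; _:=_; con)
  open import Relation.Binary.Reasoning.Setoid setoid

  Series : Set c
  Series = ℕ → Carrier

  tail : Series → Series
  tail f n = f (suc n)

  0ₛ 1ₛ var : Series
  0ₛ _        = 0#
  1ₛ zero     = 1#
  1ₛ (suc _)  = 0#
  var zero    = 0#
  var (suc n) = 1ₛ n

  infixl 7 _⊛_
  -- The Cauchy product, by recursion along f = f(0) + q `tail f`.
  _⊛_ : Series → Series → Series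
  (f ⊛ g) zero    = f 0 * g 0
  (f ⊛ g) (suc n) = f 0 * g (suc n) + (tail f ⊛ g) n

  ⊛-cong : ∀ n {f f′ g g′ : Series} → (∀ i → i ≤ n → f i ≈ f′ i) → (∀ i → i ≤ n → g i ≈ g′ i) →
           (f ⊛ g) n ≈ (f′ ⊛ g′) n
  ⊛-cong zero    p r = *-cong (p 0 z≤n) (r 0 z≤n)
  ⊛-cong (suc n) p r = +-cong (*-cong (p 0 z≤n) (r (suc n) ℕ.≤-refl))
    (⊛-cong n (λ i i≤n → p (suc i) (s≤s i≤n)) (λ i i≤n → r i (ℕ.m≤n⇒m≤1+n i≤n)))

  ⊛-zeroˡ : ∀ f n → (0ₛ ⊛ f) n ≈ 0#
  ⊛-zeroˡ f zero    = zeroˡ (f 0)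
  ⊛-zeroˡ f (suc n) = trans (+-cong (zeroˡ _) (⊛-zeroˡ f n)) (+-identityˡ 0#)

  ⊛-identityˡ : ∀ f n → (1ₛ ⊛ f) n ≈ f n
  ⊛-identityˡ f zero    = *-identityˡ (f 0)
  ⊛-identityˡ f (suc n) = trans (+-cong (*-identityˡ _) (⊛-zeroˡ f n)) (+-identityʳ _)

  ⊛-distribʳ : ∀ f g h n → ((λ i → g i + h i) ⊛ f) n ≈ (g ⊛ f) n + (h ⊛ f) n
  ⊛-distribʳ f g h zero    = distribʳ (f 0) (g 0) (h 0)
  ⊛-distribʳ f g h (suc n) = begin
    (g 0 + h 0) * f (suc n) + ((λ i → tail g i + tail h i) ⊛ f) n
      ≈⟨ +-congˡ (⊛-distribʳ f (tail g) (tail h) n) ⟩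
    (g 0 + h 0) * f (suc n) + ((tail g ⊛ f) n + (tail h ⊛ f) n)
      ≈⟨ solve 5 (λ a b c x y → (a :+ b) :* c :+ (x :+ y) := (a :* c :+ x) :+ (b :* c :+ y)) refl _ _ _ _ _ ⟩
    (g ⊛ f) (suc n) + (h ⊛ f) (suc n) ∎

  ⊛-scaleˡ : ∀ a f g n → ((λ i → a * f i) ⊛ g) n ≈ a * (f ⊛ g) n
  ⊛-scaleˡ a f g zero    = *-assoc a (f 0) (g 0)
  ⊛-scaleˡ a f g (suc n) = begin
    a * f 0 * g (suc n) + ((λ i → a * tail f i) ⊛ g) n  ≈⟨ +-cong (*-assoc a _ _) (⊛-scaleˡ a (tail f) g n) ⟩
    a * (f 0 * g (suc n)) + a * (tail f ⊛ g) n          ≈⟨ distribˡ a _ _ ⟨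
    a * (f ⊛ g) (suc n)                                 ∎

  -- The mirror image of the defining recursion, splitting off g(0) instead of f(0); commutativity
  -- follows by playing one against the other.
  ⊛-sucʳ : ∀ f g n → (f ⊛ g) (suc n) ≈ f (suc n) * g 0 + (f ⊛ tail g) n
  ⊛-sucʳ f g zero    = +-comm _ _
  ⊛-sucʳ f g (suc n) = begin
    f 0 * g (suc (suc n)) + (tail f ⊛ g) (suc n)
      ≈⟨ +-congˡ (⊛-sucʳ (tail f) g n) ⟩
    f 0 * g (suc (suc n)) + (f (suc (suc n)) * g 0 + (tail f ⊛ tail g) n)
      ≈⟨ solve 3 (λ a b c → a :+ (b :+ c) := b :+ (a :+ c)) refl _ _ _ ⟩
    f (suc (suc n)) * g 0 + (f ⊛ tail g) (suc n) ∎

  ⊛-comm : ∀ f g n → (f ⊛ g) n ≈ (g ⊛ f) n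
  ⊛-comm f g zero    = *-comm (f 0) (g 0)
  ⊛-comm f g (suc n) = trans (+-cong (*-comm _ _) (⊛-comm (tail f) g n)) (sym (⊛-sucʳ g f n))

  ⊛-assoc : ∀ f g h n → ((f ⊛ g) ⊛ h) n ≈ (f ⊛ (g ⊛ h)) n
  ⊛-assoc f g h zero    = *-assoc (f 0) (g 0) (h 0)
  ⊛-assoc f g h (suc n) = begin
    f 0 * g 0 * h (suc n) + (tail (f ⊛ g) ⊛ h) n
      ≈⟨ +-congˡ (⊛-distribʳ h (λ i → f 0 * tail g i) (tail f ⊛ g) n) ⟩
    f 0 * g 0 * h (suc n) + (((λ i → f 0 * tail g i) ⊛ h) n + ((tail f ⊛ g) ⊛ h) n)
      ≈⟨ +-congˡ (+-cong (⊛-scaleˡ (f 0) (tail g) h n) (⊛-assoc (tail f) g h n)) ⟩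
    f 0 * g 0 * h (suc n) + (f 0 * (tail g ⊛ h) n + (tail f ⊛ (g ⊛ h)) n)
      ≈⟨ solve 5 (λ a b c x y → a :* b :* c :+ (a :* x :+ y) := a :* (b :* c :+ x) :+ y) refl _ _ _ _ _ ⟩
    (f ⊛ (g ⊛ h)) (suc n) ∎

  ⊛-identityʳ : ∀ f n → (f ⊛ 1ₛ) n ≈ f n
  ⊛-identityʳ f n = trans (⊛-comm f 1ₛ n) (⊛-identityˡ f n)

  ⊛-distribˡ : ∀ f g h n → (f ⊛ (λ i → g i + h i)) n ≈ (f ⊛ g) n + (f ⊛ h) n
  ⊛-distribˡ f g h n = begin
    (f ⊛ (λ i → g i + h i)) n   ≈⟨ ⊛-comm f _ n ⟩
    ((λ i → g i + h i) ⊛ f) n   ≈⟨ ⊛-distribʳ f g h n ⟩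
    (g ⊛ f) n + (h ⊛ f) n       ≈⟨ +-cong (⊛-comm g f n) (⊛-comm h f n) ⟩
    (f ⊛ g) n + (f ⊛ h) n       ∎

  var-⊛-zero : ∀ f → (var ⊛ f) 0 ≈ 0#
  var-⊛-zero f = zeroˡ (f 0)

  var-⊛-suc : ∀ f n → (var ⊛ f) (suc n) ≈ f n
  var-⊛-suc f n = trans (+-cong (zeroˡ _) (⊛-identityˡ f n)) (+-identityˡ _)

  infix 4 _≈[_]_
  record _≈[_]_ (f : Series) (N : ℕ) (g : Series) : Set ℓ where
    constructor mk≈
    field coeff : ∀ n → n ≤ N → f n ≈ g n
  open _≈[_]_ public

  -- Power series modulo q^(N+1).
  truncated : ℕ → CommutativeRing c ℓ
  truncated N = record
    { Carrier = Series
    ; _≈_     = _≈[ N ]_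
    ; _+_     = λ f g n → f n + g n
    ; _*_     = _⊛_
    ; -_      = λ f n → - f n
    ; 0#      = 0ₛ
    ; 1#      = 1ₛ
    ; isCommutativeRing = record
      { isRing = record
        { +-isAbelianGroup = record
          { isGroup = record
            { isMonoid = record
              { isSemigroup = record
                { isMagma = record
                  { isEquivalence = record
                    { refl  = mk≈ λ _ _ → refl
                    ; sym   = λ p → mk≈ λ n n≤N → sym (coeff p n n≤N)
                    ; trans = λ p r → mk≈ λ n n≤N → trans (coeff p n n≤N) (coeff r n n≤N)
                    }
                  ; ∙-cong = λ p r → mk≈ λ n n≤N → +-cong (coeff p n n≤N) (coeff r n n≤N)
                  }
                ; assoc = λ f g h → mk≈ λ n _ → +-assoc (f n) (g n) (h n)
                }
              ; identity = (λ f → mk≈ λ n _ → +-identityˡ (f n)) , λ f → mk≈ λ n _ → +-identityʳ (f n)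
              }
            ; inverse = (λ f → mk≈ λ n _ → -‿inverseˡ (f n)) , λ f → mk≈ λ n _ → -‿inverseʳ (f n)
            ; ⁻¹-cong = λ p → mk≈ λ n n≤N → -‿cong (coeff p n n≤N)
            }
          ; comm = λ f g → mk≈ λ n _ → +-comm (f n) (g n)
          }
        ; *-cong     = λ p r → mk≈ λ n n≤N → ⊛-cong n
            (λ i i≤n → coeff p i (ℕ.≤-trans i≤n n≤N)) (λ i i≤n → coeff r i (ℕ.≤-trans i≤n n≤N))
        ; *-assoc    = λ f g h → mk≈ λ n _ → ⊛-assoc f g h n
        ; *-identity = (λ f → mk≈ λ n _ → ⊛-identityˡ f n) , λ f → mk≈ λ n _ → ⊛-identityʳ f n
        ; distrib    = (λ f g h → mk≈ λ n _ → ⊛-distribˡ f g h n) , λ f g h → mk≈ λ n _ → ⊛-distribʳ f g h n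
        }
      ; *-comm = λ f g → mk≈ λ n _ → ⊛-comm f g n
      }
    }

-- Enumeration of overpartitions

Enumerates : {X : Set} → (X → Set) → List X → Set
Enumerates P L = Unique L × (∀ x → (x ∈ L) ⇔ P x)

module _ {X : Set} where

  Enumerates-resp-⇔ : {P Q : X → Set} {L : List X} → (∀ x → P x ⇔ Q x) → Enumerates P L → Enumerates Q L
  Enumerates-resp-⇔ P⇔Q (unique , ∈⇔) = unique , λ x → P⇔Q x ⇔-∘ ∈⇔ x

  Enumerates-[] : {P : X → Set} → (∀ x → ¬ P x) → Enumerates P []
  Enumerates-[] ¬P = [] , λ x → mk⇔ (λ ()) (λ p → ⊥-elim (¬P x p))

  Enumerates-++ : {P Q : X → Set} {L M : List X} → (∀ x → P x → ¬ Q x) →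
    Enumerates P L → Enumerates Q M → Enumerates (λ x → P x ⊎ Q x) (L ++ M)
  Enumerates-++ disjoint (uniqueL , ∈L) (uniqueM , ∈M) =
    Unique.++⁺ uniqueL uniqueM
      (λ {x} (x∈L , x∈M) → disjoint x (Equivalence.to (∈L x) x∈L) (Equivalence.to (∈M x) x∈M)) ,
    λ x → mk⇔ (Sum.map (Equivalence.to (∈L x)) (Equivalence.to (∈M x)))
              (Sum.map (Equivalence.from (∈L x)) (Equivalence.from (∈M x))) ⇔-∘ ++-∈⇔

  Enumerates-map : {P : X → Set} {L : List X} {h : X → X} → (∀ {x y} → h x ≡ h y → x ≡ y) →
    Enumerates P L → Enumerates (λ x → ∃ λ y → x ≡ h y × P y) (map h L)
  Enumerates-map h-injective (unique , ∈L) =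
    Unique.map⁺ h-injective unique ,
    λ x → mk⇔ (λ x∈ → let (y , y∈L , x≡hy) = ∈-map⁻ _ x∈ in y , x≡hy , Equivalence.to (∈L y) y∈L)
              (λ { (y , ≡.refl , Py) → ∈-map⁺ _ (Equivalence.from (∈L y) Py) })

  -- Multiplication of the generating function of G by q^k.
  shift : ℕ → (ℕ → List X) → ℕ → List X
  shift zero    G n       = G n
  shift (suc k) G zero    = []
  shift (suc k) G (suc n) = shift k G n

  shift-cong : ∀ k n {G H : ℕ → List X} → (∀ i → n ≡ k ℕ.+ i → G i ≡ H i) → shift k G n ≡ shift k H n
  shift-cong zero    n       G≡H = G≡H n ≡.refl
  shift-cong (suc k) zero    G≡H = ≡.refl
  shift-cong (suc k) (suc n) G≡H = shift-cong k n λ i n≡k+i → G≡H i (≡.cong suc n≡k+i)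

  -- An enumeration is demanded only at the index n - k that is really read, so that a well-founded
  -- recursion on n can supply it when k is positive.
  Enumerates-shift : ∀ k n {P : ℕ → X → Set} {G : ℕ → List X} →
    (∀ i → n ≡ k ℕ.+ i → Enumerates (P i) (G i)) →
    Enumerates (λ x → ∃ λ i → n ≡ k ℕ.+ i × P i x) (shift k G n)
  Enumerates-shift zero n enum = Enumerates-resp-⇔
    (λ x → mk⇔ (λ p → n , ≡.refl , p) (λ { (_ , ≡.refl , p) → p })) (enum n ≡.refl)
  Enumerates-shift (suc k) zero enum = Enumerates-[] λ { _ (_ , () , _) }
  Enumerates-shift (suc k) (suc n) enum = Enumerates-resp-⇔
    (λ x → mk⇔ (λ (i , eq , p) → i , ≡.cong suc eq , p) (λ (i , eq , p) → i , ℕ.suc-injective eq , p))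
    (Enumerates-shift k n λ i eq → enum i (≡.cong suc eq))

  module _ (b : ℕ) (h : X → X) (G : ℕ → List X) where

    -- The recursive call sits under `shift`, where the drop in size is not structural, so the
    -- recursion is on a separate bound. Stopping at `G n` with no fuel left is correct for n = 0,
    -- where the shifted list is empty.
    star-fuel : ℕ → ℕ → List X
    star-fuel zero       n = G n
    star-fuel (suc fuel) n = G n ++ shift (suc b) (map h ∘ star-fuel fuel) n

    -- Each unfolding lowers the size by b + 1 ≥ 1, so at size n any fuel from n on gives the same
    -- list.
    star-fuel-irrelevant : ∀ f g n → n ≤ f → n ≤ g → star-fuel f n ≡ star-fuel g n
    star-fuel-irrelevant zero    zero    n z≤n _ = ≡.refl
    star-fuel-irrelevant zero    (suc g) n z≤n _ = ≡.sym (++-identityʳ _)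
    star-fuel-irrelevant (suc f) zero    n _ z≤n = ++-identityʳ _
    star-fuel-irrelevant (suc f) (suc g) n n≤f n≤g = ≡.cong (G n ++_) (shift-cong (suc b) n λ where
      i ≡.refl → ≡.cong (map h) (star-fuel-irrelevant f g i
        (ℕ.≤-trans (ℕ.m≤n+m i b) (ℕ.≤-pred n≤f)) (ℕ.≤-trans (ℕ.m≤n+m i b) (ℕ.≤-pred n≤g))))

    -- Division of the generating function of G by 1 - q^(b+1).
    star : ℕ → List X
    star n = star-fuel n n

    star-unfold : ∀ n → star n ≡ G n ++ shift (suc b) (map h ∘ star) n
    star-unfold zero    = ≡.sym (++-identityʳ _)
    star-unfold (suc n) = ≡.cong (G (suc n) ++_) (shift-cong (suc b) (suc n) λ where
      i ≡.refl → ≡.cong (map h) (star-fuel-irrelevant n i i (ℕ.m≤n+m i b) ℕ.≤-refl))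

    -- Well-founded induction on n: an object of size n in Q is either in P or of the form `h y`
    -- with y in Q and smaller by b + 1. Disjointness and injectivity of h keep the list free of
    -- duplicates.
    Enumerates-star : {P Q : ℕ → X → Set} → (∀ {x y} → h x ≡ h y → x ≡ y) →
      (∀ n x y → P n x → ¬ x ≡ h y) →
      (∀ n x → (P n x ⊎ ∃ λ i → n ≡ suc b ℕ.+ i × ∃ λ y → x ≡ h y × Q i y) ⇔ Q n x) →
      (∀ n → Enumerates (P n) (G n)) → ∀ n → Enumerates (Q n) (star n)
    Enumerates-star {P} {Q} h-injective disjoint split enum = <-rec _ λ n rec →
      ≡.subst (Enumerates (Q n)) (≡.sym (star-unfold n))
        (Enumerates-resp-⇔ (split n)
          (Enumerates-++ (λ { x p (_ , _ , y , x≡hy , _) → disjoint n x y p x≡hy })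
            (enum n)
            (Enumerates-shift (suc b) n λ { i ≡.refl → Enumerates-map h-injective (rec (s≤s (ℕ.m≤n+m i b))) })))

module _ {A : Set} {R : Rel A 0ℓ} where

  Linked-∷ : ∀ {x xs} → All (R x) xs → Linked R xs → Linked R (x ∷ xs)
  Linked-∷ []        []  = [-]
  Linked-∷ (r ∷ _)   l   = r ∷ l

  Linked-All : Transitive R → ∀ {x xs} → Linked R (x ∷ xs) → All (R x) xs
  Linked-All tr [-]     = []
  Linked-All tr (r ∷ l) = Linked⇒All tr r l

-- Splitting off the largest part

PartitionUpTo : ℕ → List ℕ → Set
PartitionUpTo b μ = IsPartitionList μ × All (_≤ b) μ

PartitionUpTo-suc : ∀ b {μ} → PartitionUpTo b μ → PartitionUpTo (suc b) μ
PartitionUpTo-suc b (part , μ≤b) = part , All.map ℕ.m≤n⇒m≤1+n μ≤b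

PartitionUpTo-∷ : ∀ b {μ} → PartitionUpTo (suc b) μ → PartitionUpTo (suc b) (suc b ∷ μ)
PartitionUpTo-∷ b ((linked , pos) , μ≤b) = (Linked-∷ μ≤b linked , s≤s z≤n ∷ pos) , ℕ.≤-refl ∷ μ≤b

-- By monotonicity the head decides. The remainder keeps the bound b + 1 because parts may repeat;
-- this is what produces the factor 1/(1 - q^(b+1)).
PartitionUpTo-split : ∀ b {μ} → PartitionUpTo (suc b) μ →
  PartitionUpTo b μ ⊎ ∃ λ μ′ → μ ≡ suc b ∷ μ′ × PartitionUpTo (suc b) μ′
PartitionUpTo-split b {[]} ((linked , pos) , _) = inj₁ ((linked , pos) , [])
PartitionUpTo-split b {x ∷ μ} ((linked , px ∷ pos) , x≤ ∷ μ≤) with ℕ.m≤n⇒m<n∨m≡n x≤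
... | inj₁ x<1+b = inj₁ ((linked , px ∷ pos) ,
  ℕ.≤-pred x<1+b ∷ All.map (λ y≤x → ℕ.≤-trans y≤x (ℕ.≤-pred x<1+b)) (Linked-All (λ p r → ℕ.≤-trans r p) linked))
... | inj₂ ≡.refl = inj₂ (μ , ≡.refl , (Linked.tail linked , pos) , μ≤)

-- The bound is stated for the halves of the parts, so that c is the number of factors of the
-- product in y = q².
DistinctEvenUpTo : ℕ → List ℕ → Set
DistinctEvenUpTo c ν = IsDistinctEvenList ν × All (_≤ c ℕ.+ c) ν

DistinctEvenUpTo-suc : ∀ c {ν} → DistinctEvenUpTo c ν → DistinctEvenUpTo (suc c) ν
DistinctEvenUpTo-suc c (dist , ν≤) =
  dist , All.map (λ y≤ → ℕ.≤-trans y≤ (ℕ.+-mono-≤ (ℕ.n≤1+n c) (ℕ.n≤1+n c))) ν≤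

k*2≡k+k : ∀ k → k ℕ.* 2 ≡ k ℕ.+ k
k*2≡k+k = ℕ-solve-∀

DistinctEvenUpTo-∷ : ∀ c {ν} → DistinctEvenUpTo c ν → DistinctEvenUpTo (suc c) (suc c ℕ.+ suc c ∷ ν)
DistinctEvenUpTo-∷ c ((linked , even) , ν≤) =
  (Linked-∷ (All.map (λ y≤ → ℕ.≤-<-trans y≤ (ℕ.+-mono-< (ℕ.n<1+n c) (ℕ.n<1+n c))) ν≤) linked ,
   (s≤s z≤n , divides (suc c) (≡.sym (k*2≡k+k (suc c)))) ∷ even) ,
  ℕ.≤-refl ∷ proj₂ (DistinctEvenUpTo-suc c ((linked , even) , ν≤))

even-< : ∀ c {x} → 2 ∣ x → x < suc c ℕ.+ suc c → x ≤ c ℕ.+ c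
even-< c (divides k ≡.refl) x< =
  ℕ.≤-trans (ℕ.*-monoˡ-≤ 2 (ℕ.≤-pred (ℕ.*-cancelʳ-< 2 k (suc c) (ℕ.<-≤-trans x< (ℕ.≤-reflexive (≡.sym (k*2≡k+k (suc c))))))))
    (ℕ.≤-reflexive (k*2≡k+k c))

-- Here the remainder drops to the bound c: by distinctness its parts are below 2c + 2, and by
-- evenness at most 2c. This gives the factor 1 + y^(c+1) instead of a geometric series.
DistinctEvenUpTo-split : ∀ c {ν} → DistinctEvenUpTo (suc c) ν →
  DistinctEvenUpTo c ν ⊎ ∃ λ ν′ → ν ≡ suc c ℕ.+ suc c ∷ ν′ × DistinctEvenUpTo c ν′
DistinctEvenUpTo-split c {[]} ((linked , even) , _) = inj₁ ((linked , even) , [])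
DistinctEvenUpTo-split c {x ∷ ν} ((linked , ex ∷ even) , x≤ ∷ ν≤) with ℕ.m≤n⇒m<n∨m≡n x≤
... | inj₁ x< = inj₁ ((linked , ex ∷ even) ,
  even-< c (proj₂ ex) x< ∷
  All.map (λ y<x → ℕ.≤-trans (ℕ.<⇒≤ y<x) (even-< c (proj₂ ex) x<)) (Linked-All (λ p r → ℕ.<-trans r p) linked))
... | inj₂ ≡.refl = inj₂ (ν , ≡.refl , (Linked.tail linked , even) ,
  All.zipWith (λ ((_ , 2∣y) , y<x) → even-< c 2∣y y<x) (even , Linked-All (λ p r → ℕ.<-trans r p) linked))

Pair : Set
Pair = List ℕ × List ℕ

OverpartitionUpTo : ℕ → ℕ → ℕ → Pair → Set
OverpartitionUpTo b c n (μ , ν) = PartitionUpTo b μ × DistinctEvenUpTo c ν × sum μ ℕ.+ sum ν ≡ n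

consμ consν : ℕ → Pair → Pair
consμ x (μ , ν) = x ∷ μ , ν
consν x (μ , ν) = μ , x ∷ ν

consμ-injective : ∀ x {p r} → consμ x p ≡ consμ x r → p ≡ r
consμ-injective x ≡.refl = ≡.refl

consν-injective : ∀ x {p r} → consν x p ≡ consν x r → p ≡ r
consν-injective x ≡.refl = ≡.refl

overlined : ℕ → ℕ → List Pair
overlined zero    zero    = ([] , []) ∷ []
overlined zero    (suc n) = []
overlined (suc c) n       = overlined c n ++ shift (suc c ℕ.+ suc c) (map (consν (suc c ℕ.+ suc c)) ∘ overlined c) n

-- The lists follow the generating function factor by factor: `overlined` is the numerator up to
-- exponent 2c, and each `star` divides by one 1 - q^i. Lengths can then be computed without looking
-- at the entries.
overpartitions : ℕ → ℕ → ℕ → List Pair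
overpartitions zero    c = overlined c
overpartitions (suc b) c = star b (consμ (suc b)) (overpartitions b c)

sum-consν : ∀ m x s {n} → m ℕ.+ (x ℕ.+ s) ≡ n → n ≡ x ℕ.+ (m ℕ.+ s)
sum-consν m x s ≡.refl = lemma m x s
  where
  lemma : ∀ m x s → m ℕ.+ (x ℕ.+ s) ≡ x ℕ.+ (m ℕ.+ s)
  lemma = ℕ-solve-∀

overlined-enumerates : ∀ c n → Enumerates (OverpartitionUpTo 0 c n) (overlined c n)
overlined-enumerates zero zero = [] ∷ [] , λ p → mk⇔
  (λ { (here ≡.refl) → (([] , []) , []) , (([] , []) , []) , ≡.refl })
  (λ { (((_ , []) , []) , ((_ , []) , []) , _) → here ≡.refl
     ; (((_ , s≤s _ ∷ _) , () ∷ _) , _)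
     ; (((_ , []) , []) , ((_ , (s≤s _ , _) ∷ _) , () ∷ _) , _) })
overlined-enumerates zero (suc n) = Enumerates-[] λ
  { _ (((_ , []) , []) , ((_ , []) , []) , ())
  ; _ (((_ , s≤s _ ∷ _) , () ∷ _) , _)
  ; _ (((_ , []) , []) , ((_ , (s≤s _ , _) ∷ _) , () ∷ _) , _) }
overlined-enumerates (suc c) n = Enumerates-resp-⇔ split
  (Enumerates-++ disjoint (overlined-enumerates c n)
    (Enumerates-shift 2c n λ i _ → Enumerates-map (consν-injective 2c) (overlined-enumerates c i)))
  where
  2c = suc c ℕ.+ suc c
  New : Pair → Set
  New p = ∃ λ i → n ≡ 2c ℕ.+ i × ∃ λ r → p ≡ consν 2c r × OverpartitionUpTo 0 c i r
  disjoint : ∀ p → OverpartitionUpTo 0 c n p → ¬ New p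
  disjoint _ (_ , (_ , 2c≤ ∷ _) , _) (_ , _ , _ , ≡.refl , _) =
    ℕ.<⇒≱ (ℕ.+-mono-< (ℕ.n<1+n c) (ℕ.n<1+n c)) 2c≤
  split : ∀ p → (OverpartitionUpTo 0 c n p ⊎ New p) ⇔ OverpartitionUpTo 0 (suc c) n p
  split p = mk⇔
    (λ { (inj₁ (part , dist , eq)) → part , DistinctEvenUpTo-suc c dist , eq
       ; (inj₂ (_ , eq , (μ , ν) , ≡.refl , part , dist , ≡.refl)) →
           part , DistinctEvenUpTo-∷ c dist , ≡.trans (sum-consν (sum μ) 2c (sum ν) ≡.refl) (≡.sym eq) })
    (λ { (part , dist , eq) → Sum.map
         (λ dist′ → part , dist′ , eq)
         (λ { (ν′ , ≡.refl , dist′) → _ , sum-consν (sum (proj₁ p)) 2c (sum ν′) eq , (proj₁ p , ν′) , ≡.refl , part , dist′ , ≡.refl })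
         (DistinctEvenUpTo-split c dist) })

overpartitions-enumerates : ∀ b c n → Enumerates (OverpartitionUpTo b c n) (overpartitions b c n)
overpartitions-enumerates zero    c = overlined-enumerates c
overpartitions-enumerates (suc b) c = Enumerates-star b (consμ (suc b)) (overpartitions b c)
  (consμ-injective (suc b))
  (λ { n _ _ ((_ , b<b ∷ _) , _) ≡.refl → ℕ.n≮n b b<b })
  (λ n p → mk⇔
    (λ { (inj₁ (part , rest)) → PartitionUpTo-suc b part , rest
       ; (inj₂ (_ , eq , (μ , ν) , ≡.refl , part , dist , ≡.refl)) →
           PartitionUpTo-∷ b part , dist , ≡.trans (ℕ.+-assoc (suc b) (sum μ) (sum ν)) (≡.sym eq) })
    (λ { (part , dist , eq) → Sum.map
         (λ part′ → part′ , dist , eq)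
         (λ { (μ′ , ≡.refl , part′) → _ , ≡.trans (≡.sym eq) (ℕ.+-assoc (suc b) (sum μ′) (sum (proj₂ p))) ,
               (μ′ , proj₂ p) , ≡.refl , part′ , dist , ≡.refl })
         (PartitionUpTo-split b part) }))
  (overpartitions-enumerates b c)

All-≤-sum : ∀ xs → All (_≤ sum xs) xs
All-≤-sum []       = []
All-≤-sum (x ∷ xs) =
  ℕ.m≤m+n x (sum xs) ∷ All.map (λ y≤ → ℕ.≤-trans y≤ (ℕ.m≤n+m (sum xs) x)) (All-≤-sum xs)

-- Every part is at most n ≤ 2n, so the bounded lists contain all overpartitions of n. The bound 2n
-- for both kinds of parts is the one that the splitting by parity requires.
enumerates-d₂ : ∀ n → Enumerates-d₂ n (overpartitions (n ℕ.+ n) n n)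
enumerates-d₂ n = Enumerates-resp-⇔
  (λ (μ , ν) → mk⇔
    (λ ((part , _) , (dist , _) , eq) → part , dist , eq)
    (λ { (part , dist , ≡.refl) →
      (part , All.map (λ y≤ → ℕ.≤-trans y≤ (ℕ.≤-trans (ℕ.m≤m+n (sum μ) (sum ν)) (ℕ.m≤m+n _ _))) (All-≤-sum μ)) ,
      (dist , All.map (λ y≤ → ℕ.≤-trans y≤ (ℕ.≤-trans (ℕ.m≤n+m (sum ν) (sum μ)) (ℕ.m≤m+n _ _))) (All-≤-sum ν)) ,
      ≡.refl }))
  (overpartitions-enumerates (n ℕ.+ n) n n)

-- The generating function of d₂

open PowerSeries ℕ/4 using (Series; var; ⊛-assoc; ⊛-identityˡ; var-⊛-zero; var-⊛-suc; truncated; coeff; mk≈)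

module ℕ/4 where
  open CommutativeRing ℕ/4 public
  open RingIdentities ℕ/4 public using (ε; ε^[k+k]≈1)
  open import Algebra.Properties.Semiring.Exp semiring public using (_^_; ^-homo-*; ^-congʳ)

-- The signs by residue class of m modulo 4

sgnℕ : ℕ → ℕ
sgnℕ k = ℕ/4.ε ℕ/4.^ tri k

-- The exponent m(m+1)/2 is invariant under the reflection of m to -1 - m, which exchanges `+ j` and
-- `-[1+ j ]`.
sgn : ℤ → ℕ
sgn (+ k)    = sgnℕ k
sgn -[1+ j ] = sgnℕ j

-- `tri` grows by 4k + 10 from k to k + 4, an even number.
sgnℕ-periodic : ∀ a r → sgnℕ (a ℕ.* 4 ℕ.+ r) ≡₄ sgnℕ r
sgnℕ-periodic zero    r = ℕ/4.refl
sgnℕ-periodic (suc a) r = ℕ/4.trans (step (a ℕ.* 4 ℕ.+ r)) (sgnℕ-periodic a r)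
  where
  tri-4+ : ∀ k t → t ℕ.+ suc k ℕ.+ suc (suc k) ℕ.+ suc (suc (suc k)) ℕ.+ suc (suc (suc (suc k)))
    ≡ ((k ℕ.+ k ℕ.+ 5) ℕ.+ (k ℕ.+ k ℕ.+ 5)) ℕ.+ t
  tri-4+ = ℕ-solve-∀
  step : ∀ k → sgnℕ (4 ℕ.+ k) ≡₄ sgnℕ k
  step k = begin
    sgnℕ (4 ℕ.+ k)                       ≈⟨ ℕ/4.^-congʳ ℕ/4.ε (tri-4+ k (tri k)) ⟩
    ℕ/4.ε ℕ/4.^ (h ℕ.+ h ℕ.+ tri k)      ≈⟨ ℕ/4.^-homo-* ℕ/4.ε (h ℕ.+ h) (tri k) ⟩
    ℕ/4.ε ℕ/4.^ (h ℕ.+ h) ℕ.* sgnℕ k     ≈⟨ ℕ/4.*-congʳ (ℕ/4.ε^[k+k]≈1 h) ⟩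
    1 ℕ.* sgnℕ k                         ≈⟨ ℕ/4.*-identityˡ (sgnℕ k) ⟩
    sgnℕ k                               ∎
    where
    open import Relation.Binary.Reasoning.Setoid ℕ/4.setoid
    h = k ℕ.+ k ℕ.+ 5

4*a+r : ∀ a r → + 4 ℤ.* + a ℤ.+ + r ≡ + (a ℕ.* 4 ℕ.+ r)
4*a+r a r = ≡.cong (ℤ._+ + r) (≡.trans (≡.sym (ℤ.pos-* 4 a)) (≡.cong +_ (ℕ.*-comm 4 a)))

4*-[1+a] : ∀ a → + 4 ℤ.* -[1+ a ] ≡ -[1+ 3 ℕ.+ a ℕ.* 4 ]
4*-[1+a] a = ≡.cong -[1+_] (lemma a)
  where
  lemma : ∀ a → a ℕ.+ 3 ℕ.* suc a ≡ 3 ℕ.+ a ℕ.* 4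
  lemma = ℕ-solve-∀

-- A negative m = -[1+ 4a + r] lies in the class of 3 - r. The values of `sgnℕ` at 0, 1, 2, 3 are 1,
-- 3, 3, 1 modulo 4, so the reflected class carries the same sign.
sgn-4k+r : ∀ a r {m} → m ≡ + (a ℕ.* 4 ℕ.+ r) ⊎ m ≡ -[1+ a ℕ.* 4 ℕ.+ r ] → sgn m ≡₄ sgnℕ r
sgn-4k+r a r (inj₁ ≡.refl) = sgnℕ-periodic a r
sgn-4k+r a r (inj₂ ≡.refl) = sgnℕ-periodic a r

sgn-4k : ∀ k → sgn (+ 4 ℤ.* k) ≡₄ 1
sgn-4k (+ a)    = sgn-4k+r a 0 {+ 4 ℤ.* + a} (inj₁ (≡.trans (≡.sym (ℤ.+-identityʳ (+ 4 ℤ.* + a))) (4*a+r a 0)))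
sgn-4k -[1+ a ] = ℕ/4.trans (sgn-4k+r a 3 (inj₂ (≡.trans (4*-[1+a] a) (≡.cong -[1+_] (ℕ.+-comm 3 _))))) (mod₄ ≡.refl)

sgn-4k+1 : ∀ k → sgn (+ 4 ℤ.* k ℤ.+ + 1) ≡₄ 3
sgn-4k+1 (+ a)    = sgn-4k+r a 1 (inj₁ (4*a+r a 1))
sgn-4k+1 -[1+ a ] = ℕ/4.trans
  (sgn-4k+r a 2 (inj₂ (≡.trans (≡.cong (ℤ._+ + 1) (4*-[1+a] a)) (≡.cong -[1+_] (ℕ.+-comm 2 _))))) (mod₄ ≡.refl)

sgn-4k+2 : ∀ k → sgn (+ 4 ℤ.* k ℤ.+ + 2) ≡₄ 3
sgn-4k+2 (+ a)    = ℕ/4.trans (sgn-4k+r a 2 (inj₁ (4*a+r a 2))) (mod₄ ≡.refl)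
sgn-4k+2 -[1+ a ] =
  sgn-4k+r a 1 (inj₂ (≡.trans (≡.cong (ℤ._+ + 2) (4*-[1+a] a)) (≡.cong -[1+_] (ℕ.+-comm 1 _))))

sgn-4k+3 : ∀ k → sgn (+ 4 ℤ.* k ℤ.+ + 3) ≡₄ 1
sgn-4k+3 (+ a)    = ℕ/4.trans (sgn-4k+r a 3 (inj₁ (4*a+r a 3))) (mod₄ ≡.refl)
sgn-4k+3 -[1+ a ] =
  sgn-4k+r a 0 (inj₂ (≡.trans (≡.cong (ℤ._+ + 3) (4*-[1+a] a)) (≡.cong -[1+_] (≡.sym (ℕ.+-identityʳ _)))))

∣m∣≤1+K⇒∣m∣≤K : ∀ {K} m → ∣ m ∣ ≤ suc K → m ≢ -[1+ K ] → m ≢ + suc K → ∣ m ∣ ≤ K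
∣m∣≤1+K⇒∣m∣≤K (+ k)    k≤ _ k≢ = ℕ.≤-pred (ℕ.≤∧≢⇒< k≤ (k≢ ∘ ≡.cong +_))
∣m∣≤1+K⇒∣m∣≤K -[1+ j ] j≤ j≢ _ = ℕ.≤-pred (ℕ.≤∧≢⇒< j≤ (j≢ ∘ ≡.cong (-[1+_] ∘ ℕ.pred)))

-- Lengths of lists as truncated power series

module GeneratingFunction (N : ℕ) where
  open CommutativeRing (truncated N)
  open import Algebra.Properties.Ring ring using (-1*x≈-x)
  open import Algebra.Properties.Semiring.Exp semiring
  open import Algebra.Properties.CommutativeSemiring.Exp commutativeSemiring using (^-distrib-*)
  open RingIdentities (truncated N)

  count : (ℕ → List Pair) → Series
  count G n = length (G n)

  var^-⊛-zero : ∀ k f → (var ^ suc k * f) 0 ≡₄ 0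
  var^-⊛-zero k f = ℕ/4.trans (⊛-assoc var (var ^ k) f 0) (var-⊛-zero (var ^ k * f))

  var^-⊛-suc : ∀ k f n → (var ^ suc k * f) (suc n) ≡₄ (var ^ k * f) n
  var^-⊛-suc k f n = ℕ/4.trans (⊛-assoc var (var ^ k) f (suc n)) (var-⊛-suc (var ^ k * f) n)

  count-shift : ∀ k (h : Pair → Pair) G n → length (shift k (map h ∘ G) n) ≡₄ (var ^ k * count G) n
  count-shift zero    h G n       = ℕ/4.trans (≡⇒≡₄ (length-map h (G n))) (ℕ/4.sym (⊛-identityˡ (count G) n))
  count-shift (suc k) h G zero    = ℕ/4.sym (var^-⊛-zero k (count G))
  count-shift (suc k) h G (suc n) = ℕ/4.trans (count-shift k h G n) (ℕ/4.sym (var^-⊛-suc k (count G) n))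

  count-++-shift : ∀ k (h : Pair → Pair) F G →
    count (λ n → F n ++ shift k (map h ∘ G) n) ≈ count F + var ^ k * count G
  count-++-shift k h F G = mk≈ λ n _ →
    ℕ/4.trans (≡⇒≡₄ (length-++ (F n))) (ℕ/4.+-congˡ (count-shift k h G n))

  count-overlined : ∀ c → count (overlined c) ≈ distinct-∏ (var * var) c
  count-overlined zero    = mk≈ λ { zero _ → ℕ/4.refl ; (suc n) _ → ℕ/4.refl }
  count-overlined (suc c) = begin
    count (overlined (suc c))                                     ≈⟨ count-++-shift 2c (consν 2c) (overlined c) (overlined c) ⟩
    F + var ^ 2c * F                                              ≈⟨ +-cong (*-identityˡ F) (*-congʳ power) ⟨
    1# * F + (var * var) ^ suc c * F                              ≈⟨ distribʳ F 1# _ ⟨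
    (1# + (var * var) ^ suc c) * F                                ≈⟨ *-comm _ F ⟩
    F * (1# + (var * var) ^ suc c)                                ≈⟨ *-congʳ (count-overlined c) ⟩
    distinct-∏ (var * var) (suc c)                                ∎
    where
    open import Relation.Binary.Reasoning.Setoid setoid
    2c = suc c ℕ.+ suc c
    F = count (overlined c)
    power : (var * var) ^ suc c ≈ var ^ 2c
    power = trans (^-distrib-* var var (suc c)) (sym (^-homo-* var (suc c) (suc c)))

  count-star : ∀ b h G → count (star b h G) ≈ count G + var ^ suc b * count (star b h G)
  count-star b h G = trans
    (mk≈ λ n _ → ≡⇒≡₄ (≡.cong length (star-unfold b h G n)))
    (count-++-shift (suc b) h G (star b h G))

  -- Stated with the denominator on the left, so that each `star` cancels against its own factor and
  -- no inverse series is formed.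
  count-overpartitions : ∀ b c → ∏ var 0 b * count (overpartitions b c) ≈ distinct-∏ (var * var) c
  count-overpartitions zero    c = trans (*-identityˡ _) (count-overlined c)
  count-overpartitions (suc b) c = begin
    ∏ var 0 b * (1− (var ^ suc b)) * count (overpartitions (suc b) c)
      ≈⟨ *-assoc _ _ _ ⟩
    ∏ var 0 b * ((1− (var ^ suc b)) * count (overpartitions (suc b) c))
      ≈⟨ *-congˡ (1−-quotient (count-star b (consμ (suc b)) (overpartitions b c))) ⟩
    ∏ var 0 b * count (overpartitions b c)
      ≈⟨ count-overpartitions b c ⟩
    distinct-∏ (var * var) c ∎
    where open import Relation.Binary.Reasoning.Setoid setoid

  -- Coefficients of the signed pentagonal sum

  var^-diagonal : ∀ n → (var ^ n) n ≡₄ 1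
  var^-diagonal zero    = ℕ/4.refl
  var^-diagonal (suc n) = ℕ/4.trans (var-⊛-suc (var ^ n) n) (var^-diagonal n)

  var^-off-diagonal : ∀ w n → n ≢ w → (var ^ w) n ≡₄ 0
  var^-off-diagonal zero    zero    n≢w = ⊥-elim (n≢w ≡.refl)
  var^-off-diagonal zero    (suc n) n≢w = ℕ/4.refl
  var^-off-diagonal (suc w) zero    n≢w = var-⊛-zero (var ^ w)
  var^-off-diagonal (suc w) (suc n) n≢w =
    ℕ/4.trans (var-⊛-suc (var ^ w) n) (var^-off-diagonal w n (n≢w ∘ ≡.cong suc))

  var^[1+N]≈0 : var ^ suc N ≈ 0#
  var^[1+N]≈0 = mk≈ λ n n≤N → var^-off-diagonal (suc N) n (ℕ.<⇒≢ (s≤s n≤N))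

  4≈0 : 1# + 1# + 1# + 1# ≈ 0#
  4≈0 = mk≈ λ { zero _ → mod₄ ≡.refl ; (suc n) _ → mod₄ ≡.refl }

  count-pentagonal : count (overpartitions (N ℕ.+ N) N) ≈ signed-pentagonal-sum var (N ℕ.+ N)
  count-pentagonal = trans
    (overpartition-series 4≈0 var N var^[1+N]≈0 (count-overpartitions (N ℕ.+ N) N))
    (pentagonal-sum-−q var (N ℕ.+ N))

  -- Two minus ones are involved: the left ε is the negative of the constant series 1, the right one
  -- is the number 3. The lemma moves signs from series to coefficients.
  coeff-ε^ : ∀ t f n → n ≤ N → (ε ^ t * f) n ≡₄ ℕ/4.ε ℕ/4.^ t ℕ.* f n
  coeff-ε^ zero    f n n≤N = ℕ/4.trans (⊛-identityˡ f n) (ℕ/4.sym (ℕ/4.*-identityˡ (f n)))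
  coeff-ε^ (suc t) f n n≤N = begin
    (ε * ε ^ t * f) n                ≈⟨ ⊛-assoc ε (ε ^ t) f n ⟩
    (ε * (ε ^ t * f)) n              ≈⟨ coeff (-1*x≈-x (ε ^ t * f)) n n≤N ⟩
    3 ℕ.* (ε ^ t * f) n              ≈⟨ ℕ/4.*-congˡ {3} (coeff-ε^ t f n n≤N) ⟩
    3 ℕ.* (ℕ/4.ε ℕ/4.^ t ℕ.* f n)    ≈⟨ ℕ/4.*-assoc 3 (ℕ/4.ε ℕ/4.^ t) (f n) ⟨
    ℕ/4.ε ℕ/4.^ suc t ℕ.* f n        ∎
    where open import Relation.Binary.Reasoning.Setoid ℕ/4.setoid

  coeff-hit : ∀ t w → w ≤ N → (ε ^ t * var ^ w) w ≡₄ ℕ/4.ε ℕ/4.^ t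
  coeff-hit t w w≤N = ℕ/4.trans (coeff-ε^ t (var ^ w) w w≤N)
    (ℕ/4.trans (ℕ/4.*-congˡ {ℕ/4.ε ℕ/4.^ t} (var^-diagonal w)) (ℕ/4.*-identityʳ (ℕ/4.ε ℕ/4.^ t)))

  coeff-miss : ∀ t w n → n ≤ N → n ≢ w → (ε ^ t * var ^ w) n ≡₄ 0
  coeff-miss t w n n≤N n≢w = ℕ/4.trans (coeff-ε^ t (var ^ w) n n≤N)
    (ℕ/4.trans (ℕ/4.*-congˡ {ℕ/4.ε ℕ/4.^ t} (var^-off-diagonal w n n≢w)) (ℕ/4.zeroʳ (ℕ/4.ε ℕ/4.^ t)))

  sum-miss : ∀ K n → n ≤ N → (∀ m → ∣ m ∣ ≤ K → n ≢ ω m) → signed-pentagonal-sum var K n ≡₄ 0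
  sum-miss zero    n n≤N miss = var^-off-diagonal 0 n (miss (+ 0) z≤n)
  sum-miss (suc K) n n≤N miss = ℕ/4.+-cong
    (sum-miss K n n≤N λ m ∣m∣≤K → miss m (ℕ.m≤n⇒m≤1+n ∣m∣≤K))
    (ℕ/4.+-cong (coeff-miss (tri K) (ω -[1+ K ]) n n≤N (miss -[1+ K ] ℕ.≤-refl))
                (coeff-miss (tri (suc K)) (ω (+ suc K)) n n≤N (miss (+ suc K) ℕ.≤-refl)))

  sum-below : ∀ K m → ω m ≤ N → K < ∣ m ∣ → signed-pentagonal-sum var K (ω m) ≡₄ 0
  sum-below K m ωm≤N K<∣m∣ = sum-miss K (ω m) ωm≤N λ m′ ∣m′∣≤K eq →
    ℕ.<⇒≱ K<∣m∣ (≡.subst (λ i → ∣ i ∣ ≤ K) (≡.sym (ω-injective m m′ eq)) ∣m′∣≤K)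

  -- The term of m enters when K reaches |m|. Before that the coefficient is 0, and every other term
  -- misses the exponent ω m because ω is injective.
  sum-hit : ∀ K m → ω m ≤ N → ∣ m ∣ ≤ K → signed-pentagonal-sum var K (ω m) ≡₄ sgn m
  sum-hit zero    (+ zero) _  _ = ℕ/4.refl
  sum-hit (suc K) m ωm≤N ∣m∣≤ with m ℤ.≟ -[1+ K ] | m ℤ.≟ + suc K
  ... | yes ≡.refl | _ = ℕ/4.trans
    (ℕ/4.+-cong (sum-below K m ωm≤N ℕ.≤-refl)
      (ℕ/4.+-cong (coeff-hit (tri K) (ω m) ωm≤N)
        (coeff-miss (tri (suc K)) (ω (+ suc K)) (ω m) ωm≤N λ eq → contradiction (ω-injective m (+ suc K) eq) λ ())))
    (ℕ/4.+-identityʳ (sgn m))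
  ... | no m≢- | yes ≡.refl = ℕ/4.+-cong (sum-below K m ωm≤N ℕ.≤-refl)
    (ℕ/4.+-cong (coeff-miss (tri K) (ω -[1+ K ]) (ω m) ωm≤N (m≢- ∘ ω-injective m -[1+ K ]))
      (coeff-hit (tri (suc K)) (ω m) ωm≤N))
  ... | no m≢- | no m≢+ = ℕ/4.trans
    (ℕ/4.+-cong (sum-hit K m ωm≤N (∣m∣≤1+K⇒∣m∣≤K m ∣m∣≤ m≢- m≢+))
      (ℕ/4.+-cong (coeff-miss (tri K) (ω -[1+ K ]) (ω m) ωm≤N (m≢- ∘ ω-injective m -[1+ K ]))
        (coeff-miss (tri (suc K)) (ω (+ suc K)) (ω m) ωm≤N (m≢+ ∘ ω-injective m (+ suc K)))))
    (ℕ/4.+-identityʳ (sgn m))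

-- Reading off d₂ modulo 4

open GeneratingFunction using (count-pentagonal; sum-hit; sum-miss)

d₂ : ℕ → ℕ
d₂ n = length (overpartitions (n ℕ.+ n) n n)

d₂-hit : ∀ n m {s} → IsOmega n m → sgn m ≡₄ s → d₂ n % 4 ≡ s % 4
d₂-hit n m isω sgn≡s with ≡.refl ← IsOmega⇒≡ω n m isω = %₄ (ℕ/4.trans
  (coeff (count-pentagonal n) n ℕ.≤-refl)
  -- The range of summation contains m, since |m| ≤ ω m = n ≤ 2n.
  (ℕ/4.trans (sum-hit n (n ℕ.+ n) m ℕ.≤-refl (ℕ.≤-trans (∣m∣≤ω m) (ℕ.m≤m+n n n))) sgn≡s))

d₂-miss : ∀ n → (∀ m → ¬ IsOmega n m) → d₂ n % 4 ≡ 0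
d₂-miss n miss = %₄ (ℕ/4.trans
  (coeff (count-pentagonal n) n ℕ.≤-refl)
  (sum-miss n (n ℕ.+ n) n ℕ.≤-refl λ m _ n≡ωm → miss m (≡.subst (λ k → IsOmega k m) (≡.sym n≡ωm) (ω-IsOmega m))))

IsOmega⇒case : ∀ n m → IsOmega n m → CaseOne n ⊎ CaseThree n
IsOmega⇒case n m isω with m %ℕ 4 | n%ℕd<d m 4 | a≡a%ℕn+[a/ℕn]*n m 4
... | 0 | _ | eq = inj₁ (m /ℕ 4 , inj₁ (≡.subst (IsOmega n) (≡.trans eq (lemma (m /ℕ 4))) isω))
  where
  lemma : ∀ k → + 0 ℤ.+ k ℤ.* + 4 ≡ + 4 ℤ.* k
  lemma = ℤ-solve-∀
... | 1 | _ | eq = inj₂ (m /ℕ 4 , inj₁ (≡.subst (IsOmega n) (≡.trans eq (lemma (m /ℕ 4))) isω))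
  where
  lemma : ∀ k → + 1 ℤ.+ k ℤ.* + 4 ≡ + 4 ℤ.* k ℤ.+ + 1
  lemma = ℤ-solve-∀
... | 2 | _ | eq = inj₂ (m /ℕ 4 , inj₂ (≡.subst (IsOmega n) (≡.trans eq (lemma (m /ℕ 4))) isω))
  where
  lemma : ∀ k → + 2 ℤ.+ k ℤ.* + 4 ≡ + 4 ℤ.* k ℤ.+ + 2
  lemma = ℤ-solve-∀
... | 3 | _ | eq = inj₁ (m /ℕ 4 , inj₂ (≡.subst (IsOmega n) (≡.trans eq (lemma (m /ℕ 4))) isω))
  where
  lemma : ∀ k → + 3 ℤ.+ k ℤ.* + 4 ≡ + 4 ℤ.* k ℤ.+ + 3
  lemma = ℤ-solve-∀
... | suc (suc (suc (suc _))) | s≤s (s≤s (s≤s (s≤s ()))) | _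

theorem2 : (n : ℕ) → ∃ λ (L : List (List ℕ × List ℕ)) → Enumerates-d₂ n L ×
    (CaseOne n → length L % 4 ≡ 1) ×
    (CaseThree n → length L % 4 ≡ 3) ×
    (¬ CaseOne n → ¬ CaseThree n → length L % 4 ≡ 0)
theorem2 n =
  overpartitions (n ℕ.+ n) n n , enumerates-d₂ n ,
  (λ { (k , inj₁ isω) → d₂-hit n (+ 4 ℤ.* k) isω (sgn-4k k)
     ; (k , inj₂ isω) → d₂-hit n (+ 4 ℤ.* k ℤ.+ + 3) isω (sgn-4k+3 k) }) ,
  (λ { (k , inj₁ isω) → d₂-hit n (+ 4 ℤ.* k ℤ.+ + 1) isω (sgn-4k+1 k)
     ; (k , inj₂ isω) → d₂-hit n (+ 4 ℤ.* k ℤ.+ + 2) isω (sgn-4k+2 k) }) ,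
  -- The two cases cover all residues of m modulo 4, so failing both means that n is no ω m at all.
  λ ¬one ¬three → d₂-miss n λ m isω → Sum.[ ¬one , ¬three ] (IsOmega⇒case n m isω)
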